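{- Consider labeled chip-firing on the self-loop graph starting with $n$ chips with distinct labels from a totally ordered set, all at site $0$, where $n\equiv 3 \pmod 4$. When the process terminates (every site has at most $2$ chips), the chips are in weakly sorted order: for any chips $a<b$, the final position of $a$ is at most the final position of $b$, regardless of the choices of firing moves made.
   Context: The self-loop graph is the path graph on $\mathbb{Z}$ (each $i$ adjacent to $i\pm1$) with one self-loop at every vertex. A labeled firing move chooses three chips at a common site $i$; the one with the smallest label moves to $i-1$, the one with the largest label moves to $i+1$, and the third stays at $i$. -}

module Defs where

open import Data.Fin.Base using (Fin)
open import Data.Integer.Base using (ℤ; 0ℤ) renaming (suc to sucℤ; pred to predℤ)
open import Data.Integer.Properties using (_≟_)
open import Data.Nat.Base using (ℕ; _≤_)
open import Data.Vec.Base using (Vec; lookup; replicate; count; _[_]%=_)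
open import Relation.Binary.Bundles using (TotalOrder)
open import Relation.Binary.Construct.Closure.ReflexiveTransitive using (Star)
open import Relation.Binary.PropositionalEquality.Core using (_≡_)
import Level
import Relation.Binary.Properties.TotalOrder as TotalOrderProperties

-- The chips are the elements of Fin n; a configuration records the site of each.
Config : ℕ → Set
Config n = Vec ℤ n

initial : ∀ n → Config n
initial n = replicate n 0ℤ

Stable : ∀ {n} → Config n → Set
Stable p = ∀ i → count (_≟ i) p ≤ 2

-- The order on chips is the order of their labels, not the order of Fin n.
module LabeledFiring {c ℓ₁ ℓ₂} (O : TotalOrder c ℓ₁ ℓ₂)
                     {n : ℕ} (label : Fin n → TotalOrder.Carrier O) where

  open TotalOrderProperties O using (_<_)

  infix 4 _≺_ _⟶_ _⟶*_

  _≺_ : Fin n → Fin n → Set (ℓ₁ Level.⊔ ℓ₂)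
  x ≺ y = label x < label y

  -- The path on ℤ with a self-loop at every site is built into the move: of three
  -- chips at i, x goes to i - 1, z to i + 1, and y goes around the loop at i.
  data _⟶_ (p : Config n) : Config n → Set (ℓ₁ Level.⊔ ℓ₂) where
    fire : ∀ i {x y z} →
           lookup p x ≡ i → lookup p y ≡ i → lookup p z ≡ i →
           x ≺ y → y ≺ z →
           p ⟶ p [ x ]%= predℤ [ z ]%= sucℤ

  _⟶*_ : Config n → Config n → Set (ℓ₁ Level.⊔ ℓ₂)
  _⟶*_ = Star _⟶_

{-# OPTIONS --safe #-}

module Submission where

open import Defs
open import Data.Bool.Base using (Bool; true; false; T; not; if_then_else_; _∨_)
open import Data.Empty using (⊥; ⊥-elim)
open import Data.Fin.Base using (Fin; zero; suc; punchIn)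
open import Data.Fin.Properties using (punchInᵢ≢i) renaming (_≟_ to _≟ᶠ_)
open import Data.Integer.Base hiding (_%_) renaming (suc to sucℤ; pred to predℤ)
open import Data.Integer.Properties
open import Algebra.Properties.CommutativeMonoid.Sum +-0-commutativeMonoid using (sum; sum-cong-≗; ∑-distrib-+; sum-remove)
open import Algebra.Properties.Semiring.Sum +-*-semiring using (*-distribʳ-sum)
open import Data.Integer.Tactic.RingSolver using (solve-∀)
open import Data.List.Base as List using (List; []; _∷_; _++_)
open import Data.List.Relation.Unary.All using (All; []; _∷_)
open import Data.List.Relation.Unary.All.Properties using (++⁺)
open import Data.Nat.Base as ℕ using (ℕ; zero; suc; z≤n; s≤s; _%_)
open import Data.Nat.DivMod using (m≡m%n+[m/n]*n)
import Data.Nat.Properties as ℕₚ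
open import Data.Product.Base using (_×_; _,_; ∃; proj₁; proj₂)
open import Data.Sum.Base using (_⊎_; inj₁; inj₂)
open import Data.Unit.Base using (tt)
open import Data.Vec.Base as Vec using (Vec; []; _∷_; lookup; replicate; zipWith; count)
open import Data.Vec.Functional using (updateAt)
open import Data.Vec.Functional.Properties using (updateAt-updates; updateAt-minimal)
open import Data.Vec.Properties using (lookup∘updateAt; lookup∘updateAt′; lookup-replicate)
open import Function.Base using (_∘_; const; id)
open import Function.Definitions using (Injective)
open import Relation.Binary.Bundles using (TotalOrder)
open import Relation.Binary.Construct.Closure.ReflexiveTransitive using (Star; ε; _◅_)
open import Relation.Binary.PropositionalEquality
open import Relation.Nullary using (Dec; yes; no; ¬_)
open import Relation.Nullary.Decidable using (⌊_⌋; toWitness; fromWitness; fromWitnessFalse)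

-- Every firing at p raises Σ (x - p)⁺ by one, so a stable configuration has been reached by
-- exactly (M - |p|)² firings at p, where n = 4M - 1. Call a firing late if it is one of the last
-- M - |p| at its site. Two local invariants of the number of remaining firings show that the
-- sites next to a late firing admit only late firings, and that a late firing happens with
-- exactly three chips. Hence the late firings can all be postponed to the end, and they start
-- from three chips at 0 and two at p for 0 < |p| < M.
--
-- Colour a down-closed set of chips. Until then Σ (x - p)⁺ over the coloured chips stays below
-- the value that these chips would reach by stabilising on their own, and the same holds for the
-- others in the mirror image; at two chips per site this bounds the number of coloured chips
-- right of p. A late firing always moves a coloured chip to the left if there is one, since all
-- chips of the site take part. So a bound on that number which tightens with every firing
-- persists, and at the end it says that the smallest chips fill the sites left of 0 in order.
-- Sites right of 0 follow by reflection.

-- The labelled process is not confluent: with more than three chips at a site, a firing may pass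
-- over the coloured ones. Before the late phase the proof therefore controls only numbers of chips.
-- The stable configuration of 4M - 1 chips has one chip at 0, one at M and one at - M, and two at
-- each other site between - M and M. The lone chip at 0 is how the residue 3 modulo 4 enters: a
-- late firing at 0 has no neighbour with equally many firings left, and only the missing chip keeps
-- it down to three chips. Inversions need to be excluded only when the uncoloured chip ends left of
-- 0, say at - r - 1. There are 2 (M - r) - 1 final places left of - r, and only as many coloured
-- chips as exceed this number may end at or right of - r. The bound carried through the late phase
-- is therefore anchored at - r, where it becomes tight once no firing remains.

-- Linear arithmetic over ℤ by Fourier–Motzkin elimination

-- A row (c , d) stands for the linear form c · ρ + d.
Row : ℕ → Set
Row k = Vec ℤ k × ℤ

infix 8 _∙_
_∙_ : ∀ {k} → Vec ℤ k → Vec ℤ k → ℤ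
[] ∙ [] = 0ℤ
(c ∷ cs) ∙ (x ∷ xs) = c * x + cs ∙ xs

value : ∀ {k} → Vec ℤ k → Row k → ℤ
value ρ (c , d) = c ∙ ρ + d

infixl 6 _⊕_
infixr 7 _⊛_
_⊕_ : ∀ {k} → Row k → Row k → Row k
(c , d) ⊕ (c′ , d′) = zipWith _+_ c c′ , d + d′

_⊛_ : ∀ {k} → ℤ → Row k → Row k
a ⊛ (c , d) = Vec.map (a *_) c , a * d

unit : ∀ {k} → Fin k → Vec ℤ k
unit zero = 1ℤ ∷ replicate _ 0ℤ
unit (suc i) = 0ℤ ∷ unit i

∙-zero : ∀ {k} (ρ : Vec ℤ k) → replicate k 0ℤ ∙ ρ ≡ 0ℤ
∙-zero [] = refl
∙-zero (x ∷ ρ) = trans (+-identityˡ _) (∙-zero ρ)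

∙-unit : ∀ {k} (i : Fin k) (ρ : Vec ℤ k) → unit i ∙ ρ ≡ lookup ρ i
∙-unit zero (x ∷ ρ) = trans (cong₂ _+_ (*-identityˡ x) (∙-zero ρ)) (+-identityʳ x)
∙-unit (suc i) (x ∷ ρ) = trans (+-identityˡ _) (∙-unit i ρ)

value-⊕ : ∀ {k} (ρ : Vec ℤ k) r s → value ρ (r ⊕ s) ≡ value ρ r + value ρ s
value-⊕ ρ (c , d) (c′ , d′) = trans (cong (_+ (d + d′)) (go c c′ ρ)) (interchange (c ∙ ρ) (c′ ∙ ρ) d d′)
  where
  interchange : ∀ a b c d → (a + b) + (c + d) ≡ (a + c) + (b + d)
  interchange = solve-∀
  expand : ∀ c c′ x a b → (c + c′) * x + (a + b) ≡ (c * x + a) + (c′ * x + b)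
  expand = solve-∀
  go : ∀ {k} (c c′ ρ : Vec ℤ k) → zipWith _+_ c c′ ∙ ρ ≡ c ∙ ρ + c′ ∙ ρ
  go [] [] [] = refl
  go (c ∷ cs) (c′ ∷ cs′) (x ∷ ρ) =
    trans (cong (λ y → (c + c′) * x + y) (go cs cs′ ρ)) (expand c c′ x (cs ∙ ρ) (cs′ ∙ ρ))

value-⊛ : ∀ {k} (ρ : Vec ℤ k) a r → value ρ (a ⊛ r) ≡ a * value ρ r
value-⊛ ρ a (c , d) = trans (cong (λ y → y + a * d) (go c ρ)) (sym (*-distribˡ-+ a (c ∙ ρ) d))
  where
  expand : ∀ a c x b → a * c * x + a * b ≡ a * (c * x + b)
  expand = solve-∀
  go : ∀ {k} (c ρ : Vec ℤ k) → Vec.map (a *_) c ∙ ρ ≡ a * (c ∙ ρ)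
  go [] [] = sym (*-zeroʳ a)
  go (c ∷ cs) (x ∷ ρ) = trans (cong (λ y → a * c * x + y) (go cs ρ)) (expand a c x (cs ∙ ρ))

Holds : ∀ {k} → Vec ℤ k → Row k → Set
Holds ρ r = 0ℤ ≤ value ρ r

*-nonneg : ∀ a {b} → 0ℤ ≤ b → 0ℤ ≤ + a * b
*-nonneg a {b} 0≤b = subst (_≤ + a * b) (*-zeroʳ (+ a)) (*-monoˡ-≤-nonNeg (+ a) 0≤b)

drop : ∀ {k} → Row (suc k) → List (Row k)
drop (+0 ∷ c , d) = (c , d) ∷ []
drop _ = []

-- Both multipliers are positive, so the sum of the two scaled inequalities is again a valid
-- inequality.
resolve : ∀ {k} → Row (suc k) → Row (suc k) → List (Row k)
resolve (+[1+ a ] ∷ c , d) (-[1+ b ] ∷ c′ , d′) =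
  ((+[1+ b ] ⊛ (c , d)) ⊕ (+[1+ a ] ⊛ (c′ , d′))) ∷ []
resolve _ _ = []

resolveAll : ∀ {k} → Row (suc k) → List (Row (suc k)) → List (Row k)
resolveAll r [] = []
resolveAll r (s ∷ ss) = resolve r s ++ resolve s r ++ resolveAll r ss

eliminate : ∀ {k} → List (Row (suc k)) → List (Row k)
eliminate [] = []
eliminate (r ∷ rs) = drop r ++ resolveAll r rs ++ eliminate rs

isNegative : ℤ → Bool
isNegative (+ _) = false
isNegative -[1+ _ ] = true

-- Uses a row with value 0 to cancel the first variable of another row.
substitute : ∀ {k} → ℤ → Row k → Row (suc k) → Row k
substitute a e (b ∷ c , d) = (+ ∣ a ∣ ⊛ (c , d)) ⊕ ((- ((sign a ◃ 1) * b)) ⊛ e)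

data Pivot (k : ℕ) : Set where
  none : List (Row k) → Pivot k
  pivot : ℤ → Row k → List (Row (suc k)) → Pivot k

findPivot : ∀ {k} → List (Row (suc k)) → Pivot k
findPivot [] = none []
findPivot (r@(+0 ∷ c , d) ∷ rs) with findPivot rs
... | none ss = none ((c , d) ∷ ss)
... | pivot a e ss = pivot a e (r ∷ ss)
findPivot ((a@(+[1+ _ ]) ∷ c , d) ∷ rs) = pivot a (c , d) rs
findPivot ((a@(-[1+ _ ]) ∷ c , d) ∷ rs) = pivot a (c , d) rs

-- Refutes the system es = 0, rs ≥ 0.
refute : ∀ k → List (Row k) → List (Row k) → Bool
refute zero es [] = false
refute zero es (([] , d) ∷ rs) = isNegative d ∨ refute zero es rs
refute (suc k) es rs with findPivot es
... | none ss = refute k ss (eliminate rs)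
... | pivot a e ss = refute k (List.map (substitute a e) ss) (List.map (substitute a e) rs)

drop-sound : ∀ {k} x (ρ : Vec ℤ k) r → Holds (x ∷ ρ) r → All (Holds ρ) (drop r)
drop-sound x ρ (+0 ∷ c , d) h = subst (0ℤ ≤_) (cong (_+ d) (+-identityˡ (c ∙ ρ))) h ∷ []
drop-sound x ρ (+[1+ _ ] ∷ c , d) h = []
drop-sound x ρ (-[1+ _ ] ∷ c , d) h = []

resolve-sound : ∀ {k} x (ρ : Vec ℤ k) r s → Holds (x ∷ ρ) r → Holds (x ∷ ρ) s →
                All (Holds ρ) (resolve r s)
resolve-sound x ρ (+0 ∷ _ , _) (_ ∷ _ , _) _ _ = []
resolve-sound x ρ (-[1+ _ ] ∷ _ , _) (_ ∷ _ , _) _ _ = []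
resolve-sound x ρ (+[1+ _ ] ∷ _ , _) (+ _ ∷ _ , _) _ _ = []
resolve-sound x ρ (+[1+ a ] ∷ c , d) (-[1+ b ] ∷ c′ , d′) h h′ =
  subst (0ℤ ≤_) (sym eq) (+-mono-≤ (*-nonneg (suc b) h) (*-nonneg (suc a) h′)) ∷ []
  where
  p q : Row _
  p = c , d
  q = c′ , d′
  cancel : ∀ α β x y z e e′ → β * (y + e) + α * (z + e′) ≡
           β * (α * x + y + e) + α * (- β * x + z + e′)
  cancel = solve-∀
  eq : value ρ ((+[1+ b ] ⊛ p) ⊕ (+[1+ a ] ⊛ q)) ≡
       +[1+ b ] * (+[1+ a ] * x + c ∙ ρ + d) + +[1+ a ] * (-[1+ b ] * x + c′ ∙ ρ + d′)
  eq = trans (value-⊕ ρ (+[1+ b ] ⊛ p) (+[1+ a ] ⊛ q))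
      (trans (cong₂ _+_ (value-⊛ ρ +[1+ b ] p) (value-⊛ ρ +[1+ a ] q))
             (cancel +[1+ a ] +[1+ b ] x (c ∙ ρ) (c′ ∙ ρ) d d′))

resolveAll-sound : ∀ {k} x (ρ : Vec ℤ k) r rs → Holds (x ∷ ρ) r → All (Holds (x ∷ ρ)) rs →
                   All (Holds ρ) (resolveAll r rs)
resolveAll-sound x ρ r [] h [] = []
resolveAll-sound x ρ r (s ∷ ss) h (h′ ∷ hs) =
  ++⁺ (resolve-sound x ρ r s h h′)
      (++⁺ (resolve-sound x ρ s r h′ h) (resolveAll-sound x ρ r ss h hs))

eliminate-sound : ∀ {k} x (ρ : Vec ℤ k) rs → All (Holds (x ∷ ρ)) rs →
                  All (Holds ρ) (eliminate rs)
eliminate-sound x ρ [] [] = []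
eliminate-sound x ρ (r ∷ rs) (h ∷ hs) =
  ++⁺ (drop-sound x ρ r h) (++⁺ (resolveAll-sound x ρ r rs h hs) (eliminate-sound x ρ rs hs))

Vanishes : ∀ {k} → Vec ℤ k → Row k → Set
Vanishes ρ r = value ρ r ≡ 0ℤ

-- The row is scaled by |a| and not by a, so that substitution preserves the direction of
-- inequalities; the sign of a moves into the multiple of the vanishing row.
value-substitute : ∀ {k} x (ρ : Vec ℤ k) a c d r → Vanishes (x ∷ ρ) (a ∷ c , d) →
                   value ρ (substitute a (c , d) r) ≡ + ∣ a ∣ * value (x ∷ ρ) r
value-substitute x ρ a c d r@(b ∷ c′ , d′) a-vanishes = begin
  value ρ (substitute a (c , d) r)
    ≡⟨ value-⊕ ρ (+ ∣ a ∣ ⊛ (c′ , d′)) ((- (s * b)) ⊛ (c , d)) ⟩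
  value ρ (+ ∣ a ∣ ⊛ (c′ , d′)) + value ρ ((- (s * b)) ⊛ (c , d))
    ≡⟨ cong₂ _+_ (value-⊛ ρ (+ ∣ a ∣) (c′ , d′)) (value-⊛ ρ (- (s * b)) (c , d)) ⟩
  + ∣ a ∣ * (c′ ∙ ρ + d′) + - (s * b) * (c ∙ ρ + d)
    ≡⟨ complete (+ ∣ a ∣) a s b x (c′ ∙ ρ) d′ (c ∙ ρ) d ⟩
  + ∣ a ∣ * (b * x + c′ ∙ ρ + d′) + (s * a - + ∣ a ∣) * (b * x) + - (s * b) * (a * x + c ∙ ρ + d)
    ≡⟨ cong₂ (λ t u → + ∣ a ∣ * (b * x + c′ ∙ ρ + d′) + t * (b * x) + - (s * b) * u)
         (trans (cong (_- + ∣ a ∣) (sign-abs a)) (+-inverseʳ (+ ∣ a ∣))) a-vanishes ⟩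
  + ∣ a ∣ * (b * x + c′ ∙ ρ + d′) + 0ℤ * (b * x) + - (s * b) * 0ℤ
    ≡⟨ clean (+ ∣ a ∣ * (b * x + c′ ∙ ρ + d′)) (b * x) (- (s * b)) ⟩
  + ∣ a ∣ * (b * x + c′ ∙ ρ + d′) ∎
  where
  open ≡-Reasoning
  s = sign a ◃ 1
  sign-abs : ∀ a → (sign a ◃ 1) * a ≡ + ∣ a ∣
  sign-abs (+ n) = *-identityˡ (+ n)
  sign-abs -[1+ n ] = -1*i≡-i -[1+ n ]
  complete : ∀ m a s b x y d′ z d → m * (y + d′) + - (s * b) * (z + d) ≡
             m * (b * x + y + d′) + (s * a - m) * (b * x) + - (s * b) * (a * x + z + d)
  complete = solve-∀
  clean : ∀ t u v → t + 0ℤ * u + v * 0ℤ ≡ t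
  clean = solve-∀

module _ {k} x (ρ : Vec ℤ k) a (e : Row k) (e-vanishes : Vanishes (x ∷ ρ) (a ∷ proj₁ e , proj₂ e)) where

  substitute-vanishes : ∀ {rs} → All (Vanishes (x ∷ ρ)) rs → All (Vanishes ρ) (List.map (substitute a e) rs)
  substitute-vanishes [] = []
  substitute-vanishes (_∷_ {r} h hs) =
    trans (value-substitute x ρ a _ _ r e-vanishes) (trans (cong (+ ∣ a ∣ *_) h) (*-zeroʳ (+ ∣ a ∣)))
    ∷ substitute-vanishes hs

  substitute-holds : ∀ {rs} → All (Holds (x ∷ ρ)) rs → All (Holds ρ) (List.map (substitute a e) rs)
  substitute-holds [] = []
  substitute-holds (_∷_ {r} h hs) =
    subst (0ℤ ≤_) (sym (value-substitute x ρ a _ _ r e-vanishes)) (*-nonneg ∣ a ∣ h)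
    ∷ substitute-holds hs

PivotVanishes : ∀ {k} → ℤ → Vec ℤ k → Pivot k → Set
PivotVanishes x ρ (none ss) = All (Vanishes ρ) ss
PivotVanishes x ρ (pivot a (c , d) ss) = Vanishes (x ∷ ρ) (a ∷ c , d) × All (Vanishes (x ∷ ρ)) ss

findPivot-vanishes : ∀ {k} x (ρ : Vec ℤ k) es → All (Vanishes (x ∷ ρ)) es → PivotVanishes x ρ (findPivot es)
findPivot-vanishes x ρ [] [] = []
findPivot-vanishes x ρ ((+0 ∷ c , d) ∷ es) (h ∷ hs) with findPivot es | findPivot-vanishes x ρ es hs
... | none ss | hs′ = trans (cong (_+ d) (sym (+-identityˡ (c ∙ ρ)))) h ∷ hs′
... | pivot a e ss | h′ , hs′ = h′ , h ∷ hs′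
findPivot-vanishes x ρ ((+[1+ _ ] ∷ c , d) ∷ es) (h ∷ hs) = h , hs
findPivot-vanishes x ρ ((-[1+ _ ] ∷ c , d) ∷ es) (h ∷ hs) = h , hs

refute-sound : ∀ k (ρ : Vec ℤ k) es rs → T (refute k es rs) → All (Vanishes ρ) es → All (Holds ρ) rs → ⊥
refute-sound zero [] es (([] , + _) ∷ rs) t vs (h ∷ hs) = refute-sound zero [] es rs t vs hs
refute-sound zero [] es (([] , -[1+ n ]) ∷ rs) t vs (() ∷ hs)
refute-sound (suc k) (x ∷ ρ) es rs t vs hs with findPivot es | findPivot-vanishes x ρ es vs
... | none ss | vs′ = refute-sound k ρ ss (eliminate rs) t vs′ (eliminate-sound x ρ rs hs)
... | pivot a e ss | v , vs′ =
  refute-sound k ρ (List.map (substitute a e) ss) (List.map (substitute a e) rs) t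
    (substitute-vanishes x ρ a e v vs′) (substitute-holds x ρ a e v hs)

-- Reification of linear problems

infixl 6 _:+_ _:-_
infixl 7 _:*_
infix 4 _:≤_ _:≡_
infixr 3 _⇒_

data Expr (k : ℕ) : Set where
  var : Fin k → Expr k
  con : ℤ → Expr k
  _:+_ _:-_ : Expr k → Expr k → Expr k
  _:*_ : ℤ → Expr k → Expr k

data Problem (k : ℕ) : Set where
  _:≤_ _:≡_ : Expr k → Expr k → Problem k
  _⇒_ : Problem k → Problem k → Problem k

⟦_⟧ᵉ : ∀ {k} → Expr k → Vec ℤ k → ℤ
⟦ var i ⟧ᵉ ρ = lookup ρ i
⟦ con c ⟧ᵉ ρ = c
⟦ e :+ e′ ⟧ᵉ ρ = ⟦ e ⟧ᵉ ρ + ⟦ e′ ⟧ᵉ ρ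
⟦ e :- e′ ⟧ᵉ ρ = ⟦ e ⟧ᵉ ρ - ⟦ e′ ⟧ᵉ ρ
⟦ c :* e ⟧ᵉ ρ = c * ⟦ e ⟧ᵉ ρ

⟦_⟧ : ∀ {k} → Problem k → Vec ℤ k → Set
⟦ e :≤ e′ ⟧ ρ = ⟦ e ⟧ᵉ ρ ≤ ⟦ e′ ⟧ᵉ ρ
⟦ e :≡ e′ ⟧ ρ = ⟦ e ⟧ᵉ ρ ≡ ⟦ e′ ⟧ᵉ ρ
⟦ p ⇒ q ⟧ ρ = ⟦ p ⟧ ρ → ⟦ q ⟧ ρ

row : ∀ {k} → Expr k → Row k
row (var i) = unit i , 0ℤ
row (con c) = replicate _ 0ℤ , c
row (e :+ e′) = row e ⊕ row e′
row (e :- e′) = row e ⊕ (-1ℤ ⊛ row e′)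
row (c :* e) = c ⊛ row e

row-sound : ∀ {k} (ρ : Vec ℤ k) e → value ρ (row e) ≡ ⟦ e ⟧ᵉ ρ
row-sound ρ (var i) = trans (+-identityʳ _) (∙-unit i ρ)
row-sound ρ (con c) = trans (cong (_+ c) (∙-zero ρ)) (+-identityˡ c)
row-sound ρ (e :+ e′) = trans (value-⊕ ρ (row e) (row e′)) (cong₂ _+_ (row-sound ρ e) (row-sound ρ e′))
row-sound ρ (e :- e′) =
  trans (value-⊕ ρ (row e) (-1ℤ ⊛ row e′))
    (cong₂ _+_ (row-sound ρ e)
      (trans (value-⊛ ρ -1ℤ (row e′)) (trans (-1*i≡-i _) (cong -_ (row-sound ρ e′)))))
row-sound ρ (c :* e) = trans (value-⊛ ρ c (row e)) (cong (c *_) (row-sound ρ e))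

difference-nonneg : ∀ {k} (ρ : Vec ℤ k) e e′ → ⟦ e ⟧ᵉ ρ ≤ ⟦ e′ ⟧ᵉ ρ → Holds ρ (row (e′ :- e))
difference-nonneg ρ e e′ h = subst (0ℤ ≤_) (sym (row-sound ρ (e′ :- e))) (i≤j⇒0≤j-i h)

difference-zero : ∀ {k} (ρ : Vec ℤ k) e e′ → ⟦ e ⟧ᵉ ρ ≡ ⟦ e′ ⟧ᵉ ρ → Vanishes ρ (row (e′ :- e))
difference-zero ρ e e′ h = trans (row-sound ρ (e′ :- e)) (i≡j⇒i-j≡0 (sym h))

-- A hypothesis that is itself an implication is ignored.
Entails : ∀ {k} → List (Row k) → List (Row k) → Problem k → Set
Entails {k} es rs (e :≤ e′) = T (refute k es (row (e :- (con 1ℤ :+ e′)) ∷ rs))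
Entails es rs (e :≡ e′) = Entails es rs (e :≤ e′) × Entails es rs (e′ :≤ e)
Entails es rs ((e :≤ e′) ⇒ q) = Entails es (row (e′ :- e) ∷ rs) q
Entails es rs ((e :≡ e′) ⇒ q) = Entails (row (e′ :- e) ∷ es) rs q
Entails es rs ((_ ⇒ _) ⇒ q) = Entails es rs q

Entails-sound : ∀ {k} (ρ : Vec ℤ k) es rs p → Entails es rs p →
                All (Vanishes ρ) es → All (Holds ρ) rs → ⟦ p ⟧ ρ
-- Integrality enters here: the negated conclusion is sharpened to `1 + e′ ≤ e` before the rational
-- elimination.
Entails-sound {k} ρ es rs (e :≤ e′) t vs hs = ≮⇒≥ λ e′<e →
  refute-sound k ρ es _ t vs (difference-nonneg ρ (con 1ℤ :+ e′) e (i<j⇒suc[i]≤j e′<e) ∷ hs)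
Entails-sound ρ es rs (e :≡ e′) (t , t′) vs hs =
  ≤-antisym (Entails-sound ρ es rs (e :≤ e′) t vs hs) (Entails-sound ρ es rs (e′ :≤ e) t′ vs hs)
Entails-sound ρ es rs ((e :≤ e′) ⇒ q) t vs hs h =
  Entails-sound ρ es (row (e′ :- e) ∷ rs) q t vs (difference-nonneg ρ e e′ h ∷ hs)
Entails-sound ρ es rs ((e :≡ e′) ⇒ q) t vs hs h =
  Entails-sound ρ (row (e′ :- e) ∷ es) rs q t (difference-zero ρ e e′ h ∷ vs) hs
Entails-sound ρ es rs ((_ ⇒ _) ⇒ q) t vs hs _ = Entails-sound ρ es rs q t vs hs

Curried : ℕ → Set → Set → Set
Curried zero A B = B
Curried (suc k) A B = A → Curried k A B

uncurried : ∀ k {A B} → Curried k A B → Vec A k → B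
uncurried zero b [] = b
uncurried (suc k) f (x ∷ xs) = uncurried k (f x) xs

Universal : (k : ℕ) → (Vec ℤ k → Set) → Set
Universal zero P = P []
Universal (suc k) P = ∀ x → Universal k (λ ρ → P (x ∷ ρ))

universal : ∀ k {P : Vec ℤ k → Set} → (∀ ρ → P ρ) → Universal k P
universal zero h = h []
universal (suc k) h x = universal k (λ ρ → h (x ∷ ρ))

-- The implicit premise evaluates to the unit type when elimination refutes the negated conclusion.
linear : ∀ k (f : Curried k (Expr k) (Problem k)) →
         let p = uncurried k f (Vec.tabulate var) in
         {Entails [] [] p} → Universal k ⟦ p ⟧
linear k f {t} = universal k {⟦ uncurried k f (Vec.tabulate var) ⟧} (λ ρ → Entails-sound ρ [] [] (uncurried k f (Vec.tabulate var)) t [] [])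

-- Piecewise linear and quadratic functions on ℤ

ramp step spike : ℤ → ℤ
ramp (+ n) = + n
ramp -[1+ _ ] = 0ℤ
step (+ _) = 1ℤ
step -[1+ _ ] = 0ℤ
spike (+ 0) = 1ℤ
spike _ = 0ℤ

ramp-suc : ∀ a → ramp (sucℤ a) ≡ ramp a + step a
ramp-suc (+ n) = +-comm 1ℤ (+ n)
ramp-suc -[1+ zero ] = refl
ramp-suc -[1+ suc _ ] = refl

step-pred : ∀ a → step a ≡ step (predℤ a) + spike a
step-pred (+ zero) = refl
step-pred +[1+ _ ] = refl
step-pred -[1+ _ ] = refl

0≤ramp : ∀ a → 0ℤ ≤ ramp a
0≤ramp (+ _) = +≤+ z≤n
0≤ramp -[1+ _ ] = ≤-refl

a≤ramp : ∀ a → a ≤ ramp a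
a≤ramp (+ _) = ≤-refl
a≤ramp -[1+ _ ] = -≤+

ramp-pos : ∀ {a} → 0ℤ ≤ a → ramp a ≡ a
ramp-pos (+≤+ _) = refl

ramp-nonpos : ∀ {a} → a ≤ 0ℤ → ramp a ≡ 0ℤ
ramp-nonpos -≤+ = refl
ramp-nonpos (+≤+ z≤n) = refl

ramp-cases : ∀ a → ramp a ≡ a × 0ℤ ≤ a ⊎ ramp a ≡ 0ℤ × a ≤ -1ℤ
ramp-cases (+ _) = inj₁ (refl , +≤+ z≤n)
ramp-cases -[1+ _ ] = inj₂ (refl , -≤- z≤n)

ramp-neg : ∀ a → ramp (- a) ≡ ramp a - a
ramp-neg (+ zero) = refl
ramp-neg +[1+ n ] = sym (+-inverseʳ +[1+ n ])
ramp-neg -[1+ _ ] = refl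

0≤step : ∀ a → 0ℤ ≤ step a
0≤step (+ _) = +≤+ z≤n
0≤step -[1+ _ ] = ≤-refl

step≤1 : ∀ a → step a ≤ 1ℤ
step≤1 (+ _) = ≤-refl
step≤1 -[1+ _ ] = +≤+ z≤n

step-pos : ∀ {a} → 0ℤ ≤ a → step a ≡ 1ℤ
step-pos (+≤+ _) = refl

0≤spike : ∀ a → 0ℤ ≤ spike a
0≤spike (+ zero) = +≤+ z≤n
0≤spike +[1+ _ ] = ≤-refl
0≤spike -[1+ _ ] = ≤-refl

spike-≢ : ∀ {a} → a ≢ 0ℤ → spike a ≡ 0ℤ
spike-≢ {+ zero} a≢0 with () ← a≢0 refl
spike-≢ {+[1+ _ ]} _ = refl
spike-≢ { -[1+ _ ]} _ = refl

-- quarter k = ⌊k²/4⌋ for k ≥ 0, and 0 for k < 0.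
quarterℕ : ℕ → ℤ
quarterℕ 0 = 0ℤ
quarterℕ 1 = 0ℤ
quarterℕ (suc (suc n)) = quarterℕ n + +[1+ n ]

quarter : ℤ → ℤ
quarter (+ n) = quarterℕ n
quarter -[1+ _ ] = 0ℤ

-- k²/4 - (k - 2)²/4 = k - 1; a step of two keeps the rounding the same.
quarter-step : ∀ k → quarter k ≡ quarter (k - + 2) + ramp (k - 1ℤ)
quarter-step (+ 0) = refl
quarter-step (+ 1) = refl
quarter-step +[1+ suc n ] = refl
quarter-step -[1+ n ] = refl

quarterℕ-suc : ∀ n → quarterℕ n ≤ quarterℕ (suc n)
quarterℕ-suc 0 = ≤-refl
quarterℕ-suc 1 = +≤+ z≤n
quarterℕ-suc (suc (suc n)) = +-mono-≤ (quarterℕ-suc n) (+≤+ (ℕₚ.n≤1+n (suc n)))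

quarterℕ-mono : ∀ {a b} → a ℕ.≤′ b → quarterℕ a ≤ quarterℕ b
quarterℕ-mono ℕ.≤′-refl = ≤-refl
quarterℕ-mono {a} {suc n} (ℕ.≤′-step a≤b) = ≤-trans (quarterℕ-mono a≤b) (quarterℕ-suc n)

quarter-mono : ∀ {a b} → a ≤ b → quarter a ≤ quarter b
quarter-mono {+ a} {+ b} (+≤+ a≤b) = quarterℕ-mono {a} {b} (ℕₚ.≤⇒≤′ a≤b)
quarter-mono (-≤- _) = ≤-refl
quarter-mono { -[1+ _ ]} {+ n} -≤+ = quarterℕ-mono {0} {n} (ℕₚ.≤⇒≤′ z≤n)

-- ⌊(b + 1)²/4⌋ exceeds ⌊b²/4⌋ by ⌊(b + 1)/2⌋, which is positive from b = 1 on.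
quarter-strict : ∀ {a b} → 1ℤ ≤ b → a ≤ b → sucℤ (quarter a) ≤ quarter (sucℤ b)
quarter-strict {a} {+ suc b} 1≤b a≤b = ≤-trans (suc-mono (quarter-mono a≤b)) (go b)
  where
  go : ∀ b → sucℤ (quarterℕ (suc b)) ≤ quarterℕ (suc (suc b))
  go 0 = ≤-refl
  go (suc b) = linear 3 (λ q q′ b → q :≤ q′ ⇒
      con 1ℤ :+ (q :+ (con 1ℤ :+ b)) :≤ q′ :+ (con 1ℤ :+ (con 1ℤ :+ b)))
      (quarterℕ b) (quarterℕ (suc b)) (+ b) (quarterℕ-suc b)
quarter-strict {a} {+ zero} (+≤+ ()) _

a≤quarter[2a] : ∀ a → a ≤ quarter (+ 2 * a)
a≤quarter[2a] -[1+ _ ] = -≤+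
a≤quarter[2a] (+ n) = subst (λ k → + n ≤ quarter k) (pos-* 2 n) (go n)
  where
  go : ∀ n → + n ≤ quarterℕ (2 ℕ.* n)
  go zero = ≤-refl
  go (suc n) rewrite ℕₚ.+-suc n (n ℕ.+ 0) =
    linear 3 (λ n q r → n :≤ q ⇒ con 0ℤ :≤ r ⇒ con 1ℤ :+ n :≤ q :+ (con 1ℤ :+ r))
      (+ n) (quarterℕ (2 ℕ.* n)) (+ (2 ℕ.* n)) (go n) (+≤+ z≤n)

0≤quarter : ∀ a → 0ℤ ≤ quarter a
0≤quarter (+ n) = quarter-mono {0ℤ} {+ n} (+≤+ z≤n)
0≤quarter -[1+ _ ] = ≤-refl

sucℤ-neg : ∀ k → sucℤ -[1+ k ] ≡ - + k
sucℤ-neg zero = refl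
sucℤ-neg (suc k) = refl

-- The least-action barrier: the value at p of Σ (x - p)⁺ over s chips that start at 0
-- and stabilise, when H = ⌈s/2⌉.
barrier : ℤ → ℤ → ℤ → ℤ
barrier H s p = s * ramp (- p) + quarter (H - + 2 * + ∣ p ∣)

barrier-neg : ∀ H s p → barrier H s (- p) ≡ barrier H s p + s * p
barrier-neg H s p rewrite ∣-i∣≡∣i∣ p | neg-involutive p | ramp-neg p =
  ring s (ramp p) p (quarter (H - + 2 * + ∣ p ∣))
  where
  ring : ∀ s r p q → s * r + q ≡ s * (r - p) + q + s * p
  ring = solve-∀

-- The second difference of `barrier`: for H = ⌈s/2⌉, the number of chips at p once s chips from 0
-- have stabilised.
curvature : ℤ → ℤ → ℤ → ℤ
curvature H s (+ 0) = s - + 2 * ramp (predℤ H)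
curvature H s p = ramp (sucℤ (H - + 2 * + ∣ p ∣)) - ramp (predℤ (H - + 2 * + ∣ p ∣))

quarter-Δ : ∀ a k b → a ≡ k + + 2 → b ≡ k - + 2 →
            quarter a + quarter b ≡ + 2 * quarter k + (ramp (sucℤ k) - ramp (predℤ k))
quarter-Δ a k b refl refl = linear 5
  (λ q₀ q₁ q₂ r r′ → q₂ :≡ q₁ :+ r ⇒ q₁ :≡ q₀ :+ r′ ⇒ q₂ :+ q₀ :≡ + 2 :* q₁ :+ (r :- r′))
  (quarter (k - + 2)) (quarter k) (quarter (k + + 2)) (ramp (sucℤ k)) (ramp (predℤ k))
  (trans (quarter-step (k + + 2)) (cong₂ (λ x y → quarter x + ramp y) (e₁ k) (e₂ k)))
  (trans (quarter-step k) (cong (λ y → quarter (k - + 2) + ramp y) (+-comm k -1ℤ)))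
  where
  e₁ : ∀ k → k + + 2 - + 2 ≡ k
  e₁ = solve-∀
  e₂ : ∀ k → k + + 2 - 1ℤ ≡ 1ℤ + k
  e₂ = solve-∀

barrier-Δ⁺ : ∀ H s k → barrier H s (+ k) + barrier H s (+ suc (suc k)) ≡
             + 2 * barrier H s (+ suc k) + curvature H s (+ suc k)
barrier-Δ⁺ H s k rewrite ramp-nonpos (neg-mono-≤ (+≤+ (z≤n {k}))) =
  linear 5 (λ z a b c d → a :+ b :≡ + 2 :* c :+ d ⇒
    z :+ a :+ (z :+ b) :≡ + 2 :* (z :+ c) :+ d)
    (s * 0ℤ) _ _ (quarter (H - + 2 * + suc k)) (curvature H s (+ suc k))
    (quarter-Δ (H - + 2 * + k) (H - + 2 * + suc k) (H - + 2 * + suc (suc k)) (e₁ H (+ k)) (e₂ H (+ k)))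
  where
  e₁ : ∀ H k → H - + 2 * k ≡ H - + 2 * (1ℤ + k) + + 2
  e₁ = solve-∀
  e₂ : ∀ H k → H - + 2 * (1ℤ + (1ℤ + k)) ≡ H - + 2 * (1ℤ + k) - + 2
  e₂ = solve-∀

barrier-Δ : ∀ H s p → barrier H s (predℤ p) + barrier H s (sucℤ p) ≡
            + 2 * barrier H s p + curvature H s p
barrier-Δ H s (+ 0) = linear 6 (λ s z o a b r → z :≡ con 0ℤ ⇒ o :≡ s ⇒ b :≡ a :+ r ⇒
    o :+ a :+ (z :+ a) :≡ + 2 :* (z :+ b) :+ (s :- + 2 :* r))
  s (s * 0ℤ) (s * 1ℤ) (quarter (H - + 2)) (quarter (H - 0ℤ)) (ramp (predℤ H))
  (*-zeroʳ s) (*-identityʳ s)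
  (trans (cong quarter (+-identityʳ H))
    (trans (quarter-step H) (cong (λ y → quarter (H - + 2) + ramp y) (+-comm H -1ℤ))))
barrier-Δ H s +[1+ k ] = barrier-Δ⁺ H s k
-- The term s * p by which reflection changes the barrier is linear, so its second difference
-- vanishes and positive sites suffice.
barrier-Δ H s -[1+ k ] = begin
  barrier H s (predℤ -[1+ k ]) + barrier H s (sucℤ -[1+ k ])
    ≡⟨ cong (λ q → barrier H s (predℤ -[1+ k ]) + barrier H s q) (sucℤ-neg k) ⟩
  barrier H s (- + suc (suc k)) + barrier H s (- + k)
    ≡⟨ cong₂ _+_ (barrier-neg H s (+ suc (suc k))) (barrier-neg H s (+ k)) ⟩
  (barrier H s (+ suc (suc k)) + s * + suc (suc k)) + (barrier H s (+ k) + s * + k)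
    ≡⟨ collect s (+ k) (barrier H s (+ k)) (barrier H s (+ suc (suc k))) ⟩
  (barrier H s (+ k) + barrier H s (+ suc (suc k))) + + 2 * (s * + suc k)
    ≡⟨ cong (_+ + 2 * (s * + suc k)) (barrier-Δ⁺ H s k) ⟩
  + 2 * barrier H s (+ suc k) + c + + 2 * (s * + suc k)
    ≡⟨ regroup (barrier H s (+ suc k)) c (s * + suc k) ⟩
  + 2 * (barrier H s (+ suc k) + s * + suc k) + c
    ≡⟨ cong (λ b → + 2 * b + c) (barrier-neg H s (+ suc k)) ⟨
  + 2 * barrier H s -[1+ k ] + c ∎
  where
  open ≡-Reasoning
  c = curvature H s +[1+ k ]
  collect : ∀ s k a b → (b + s * (1ℤ + (1ℤ + k))) + (a + s * k) ≡ (a + b) + + 2 * (s * (1ℤ + k))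
  collect = solve-∀
  regroup : ∀ b c t → + 2 * b + c + + 2 * t ≡ + 2 * (b + t) + c
  regroup = solve-∀

ramp-drop : ∀ k → ramp (sucℤ k) - ramp (predℤ k) ≤ + 2
ramp-drop (+ 0) = +≤+ (s≤s z≤n)
ramp-drop +[1+ n ] = linear 1 (λ n → (con (+ 2) :+ n) :- n :≤ con (+ 2)) (+ n)
ramp-drop -[1+ 0 ] = +≤+ z≤n
ramp-drop -[1+ suc _ ] = +≤+ z≤n

-- The barrier describes a stable configuration. Away from 0 this comes from the shape of `quarter`
-- alone; at 0 it is what `s ≤ 2H` provides.
curvature-≤2 : ∀ H s p → s ≤ + 2 * H → curvature H s p ≤ + 2
curvature-≤2 H s (+ 0) s≤2H = linear 3 (λ s H r → s :≤ + 2 :* H ⇒ con -1ℤ :+ H :≤ r ⇒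
  s :- + 2 :* r :≤ con (+ 2)) s H (ramp (predℤ H)) s≤2H (a≤ramp (predℤ H))
curvature-≤2 H s p@(+[1+ _ ]) _ = ramp-drop (H - + 2 * + ∣ p ∣)
curvature-≤2 H s p@(-[1+ _ ]) _ = ramp-drop (H - + 2 * + ∣ p ∣)

1≰0 : ¬ (1ℤ ≤ 0ℤ)
1≰0 (+≤+ ())

ramp-mono : ∀ {a b} → a ≤ b → ramp a ≤ ramp b
ramp-mono (+≤+ a≤b) = +≤+ a≤b
ramp-mono (-≤- _) = ≤-refl
ramp-mono -≤+ = +≤+ z≤n

step-mono : ∀ {a b} → a ≤ b → step a ≤ step b
step-mono (+≤+ _) = ≤-refl
step-mono (-≤- _) = ≤-refl
step-mono -≤+ = +≤+ z≤n

spike-neg : ∀ a → spike (- a) ≡ spike a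
spike-neg (+ 0) = refl
spike-neg +[1+ _ ] = refl
spike-neg -[1+ _ ] = refl

step-reflect : ∀ a → step a + step (-1ℤ - a) ≡ 1ℤ
step-reflect (+ 0) = refl
step-reflect +[1+ _ ] = refl
step-reflect -[1+ 0 ] = refl
step-reflect -[1+ suc _ ] = refl

ramp-neg-suc : ∀ i → ramp (- i) + step i ≡ ramp (- sucℤ i) + 1ℤ
ramp-neg-suc (+ 0) = refl
ramp-neg-suc +[1+ _ ] = refl
ramp-neg-suc -[1+ 0 ] = refl
ramp-neg-suc -[1+ suc k ] = linear 1 (λ k → con (+ 2) :+ k :+ con 0ℤ :≡ con 1ℤ :+ k :+ con 1ℤ) (+ k)

-- The witness is ⌈a/2⌉, the parameter H of the barrier for a chips.
half-up : ∀ {a} → 0ℤ ≤ a → ∃ λ h → a ≤ + 2 * h × + 2 * h ≤ 1ℤ + a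
half-up {+ n} _ = go n
  where
  go : ∀ n → ∃ λ h → + n ≤ + 2 * h × + 2 * h ≤ 1ℤ + + n
  go 0 = 0ℤ , ≤-refl , +≤+ z≤n
  go 1 = 1ℤ , +≤+ (s≤s z≤n) , ≤-refl
  go (suc (suc n)) with go n
  ... | h , lo , hi = 1ℤ + h ,
    linear 2 (λ h n → n :≤ + 2 :* h ⇒ con (+ 2) :+ n :≤ + 2 :* (con 1ℤ :+ h)) h (+ n) lo ,
    linear 2 (λ h n → + 2 :* h :≤ con 1ℤ :+ n ⇒
      + 2 :* (con 1ℤ :+ h) :≤ con 1ℤ :+ (con (+ 2) :+ n)) h (+ n) hi

-- Coloured chips and moves

sum-mono : ∀ {n} {f g : Fin n → ℤ} → (∀ c → f c ≤ g c) → sum f ≤ sum g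
sum-mono {zero} _ = ≤-refl
sum-mono {suc n} f≤g = +-mono-≤ (f≤g zero) (sum-mono (f≤g ∘ suc))

sum-change₁ : ∀ {n} (f g : Fin n → ℤ) x → (∀ c → c ≢ x → g c ≡ f c) → sum g + f x ≡ sum f + g x
sum-change₁ {suc n} f g x same = begin
  sum g + f x                              ≡⟨ cong (_+ f x) (sum-remove {i = x} g) ⟩
  g x + sum (g ∘ punchIn x) + f x          ≡⟨ cong (λ s → g x + s + f x)
                                                (sum-cong-≗ λ c → same (punchIn x c) (punchInᵢ≢i x c)) ⟩
  g x + sum (f ∘ punchIn x) + f x          ≡⟨ swap (g x) (sum (f ∘ punchIn x)) (f x) ⟩
  f x + sum (f ∘ punchIn x) + g x          ≡⟨ cong (_+ g x) (sum-remove {i = x} f) ⟨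
  sum f + g x                              ∎
  where
  open ≡-Reasoning
  swap : ∀ a s b → a + s + b ≡ b + s + a
  swap = solve-∀

sum-change₂ : ∀ {n} (f g : Fin n → ℤ) x z → x ≢ z →
              (∀ c → c ≢ x → c ≢ z → g c ≡ f c) →
              sum g + f x + f z ≡ sum f + g x + g z
sum-change₂ f g x z x≢z same = linear 7
  (λ sg sf sh fx gx fz gz → sh :+ fx :≡ sf :+ gx ⇒ sg :+ fz :≡ sh :+ gz ⇒ sg :+ fx :+ fz :≡ sf :+ gx :+ gz)
  (sum g) (sum f) (sum h) (f x) (g x) (f z) (g z)
  (subst (λ t → sum h + f x ≡ sum f + t) hx
    (sum-change₁ f h x (λ c c≢x → updateAt-minimal c x f c≢x)))
  (subst (λ t → sum g + t ≡ sum h + g z) hz (sum-change₁ h g z off-z))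
  where
  h : Fin _ → ℤ
  h = updateAt f x (const (g x))
  hx : h x ≡ g x
  hx = updateAt-updates x f
  hz : h z ≡ f z
  hz = updateAt-minimal z x f (x≢z ∘ sym)
  off-z : ∀ c → c ≢ z → g c ≡ h c
  off-z c c≢z with c ≟ᶠ x
  ... | yes refl = sym hx
  ... | no c≢x = trans (same c c≢x c≢z) (sym (updateAt-minimal c x f c≢x))

Positions : ℕ → Set
Positions n = Fin n → ℤ

Colouring : ℕ → Set
Colouring n = Fin n → Bool

mask : Bool → ℤ → ℤ
mask b a = if b then a else 0ℤ

tally : ∀ {n} → Colouring n → (ℤ → ℤ) → Positions n → ℤ
tally w φ P = sum (λ c → mask (w c) (φ (P c)))

mask-mono : ∀ b {x y} → x ≤ y → mask b x ≤ mask b y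
mask-mono true x≤y = x≤y
mask-mono false _ = ≤-refl

mask-+ : ∀ b x y → mask b (x + y) ≡ mask b x + mask b y
mask-+ true _ _ = refl
mask-+ false _ _ = refl

module _ {n} (w : Colouring n) (P : Positions n) where

  tally-mono : ∀ {φ ψ} → (∀ a → φ a ≤ ψ a) → tally w φ P ≤ tally w ψ P
  tally-mono φ≤ψ = sum-mono (λ c → mask-mono (w c) (φ≤ψ (P c)))

  tally-cong : ∀ {φ ψ} → (∀ a → φ a ≡ ψ a) → tally w φ P ≡ tally w ψ P
  tally-cong φ≡ψ = sum-cong-≗ (λ c → cong (mask (w c)) (φ≡ψ (P c)))

  tally-+ : ∀ φ ψ → tally w (λ a → φ a + ψ a) P ≡ tally w φ P + tally w ψ P
  tally-+ φ ψ = trans (sum-cong-≗ (λ c → mask-+ (w c) (φ (P c)) (ψ (P c)))) (∑-distrib-+ (λ c → mask (w c) (φ (P c))) _)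

  tally-nonneg : ∀ {φ} → (∀ a → 0ℤ ≤ φ a) → 0ℤ ≤ tally w φ P
  tally-nonneg {φ} 0≤φ = subst (_≤ tally w φ P) zeros (tally-mono 0≤φ)
    where
    zeros : tally w (λ _ → 0ℤ) P ≡ 0ℤ
    zeros = linear 2 (λ a b → a :≡ b ⇒ b :≡ a :+ a ⇒
      a :≡ con 0ℤ) _ _ refl (tally-+ (λ _ → 0ℤ) (λ _ → 0ℤ))

  tally-not : ∀ φ → tally w φ P + tally (not ∘ w) φ P ≡ tally (λ _ → true) φ P
  tally-not φ = trans (sym (∑-distrib-+ (λ c → mask (w c) (φ (P c))) _)) (sum-cong-≗ (λ c → mask-not (w c)))
    where
    mask-not : ∀ b {x} → mask b x + mask (not b) x ≡ x
    mask-not true = +-identityʳ _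
    mask-not false = +-identityˡ _

  tally-∋ : ∀ {φ} → (∀ a → 0ℤ ≤ φ a) → ∀ {c} → T (w c) → φ (P c) ≤ tally w φ P
  tally-∋ {φ} 0≤φ {c} wc = ≤-trans (≤-reflexive (masked (w c) wc)) (term≤sum _ (λ c → mask-nonneg (w c)) c)
    where
    masked : ∀ b {x} → T b → x ≡ mask b x
    masked true _ = refl
    mask-nonneg : ∀ b {a} → 0ℤ ≤ mask b (φ a)
    mask-nonneg true = 0≤φ _
    mask-nonneg false = ≤-refl
    sum-nonneg : ∀ {n} (f : Fin n → ℤ) → (∀ c → 0ℤ ≤ f c) → 0ℤ ≤ sum f
    sum-nonneg {zero} f _ = ≤-refl
    sum-nonneg {suc n} f 0≤f = +-mono-≤ (0≤f zero) (sum-nonneg (f ∘ suc) (0≤f ∘ suc))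
    term≤sum : ∀ {n} (f : Fin n → ℤ) → (∀ c → 0ℤ ≤ f c) → ∀ c → f c ≤ sum f
    term≤sum f 0≤f zero = linear 2 (λ a b → con 0ℤ :≤ b ⇒
      a :≤ a :+ b) (f zero) _ (sum-nonneg (f ∘ suc) (0≤f ∘ suc))
    term≤sum f 0≤f (suc c) = linear 3 (λ a b t → con 0ℤ :≤ a ⇒ t :≤ b ⇒ t :≤ a :+ b) (f zero) _ _
      (0≤f zero) (term≤sum (f ∘ suc) (0≤f ∘ suc) c)

-- Chips x, y, z fire from site i; the colour selects a down-closed set among them.
record Move {n} (w : Colouring n) (i : ℤ) (P P′ : Positions n) : Set where
  field
    x y z : Fin n
    Px : P x ≡ i
    Py : P y ≡ i
    Pz : P z ≡ i
    x≢y : x ≢ y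
    y≢z : y ≢ z
    x≢z : x ≢ z
    P′x : P′ x ≡ predℤ i
    P′z : P′ z ≡ sucℤ i
    fixed : ∀ c → c ≢ x → c ≢ z → P′ c ≡ P c
    z⇒y : T (w z) → T (w y)
    y⇒x : T (w y) → T (w x)

  P′y : P′ y ≡ i
  P′y = trans (fixed y (x≢y ∘ sym) y≢z) Py

AnyMove : ∀ {n} → Colouring n → Positions n → Positions n → Set
AnyMove w P P′ = ∃ λ i → Move w i P P′

tally-move : ∀ {n} {w u : Colouring n} {i P P′} (φ : ℤ → ℤ) (mv : Move w i P P′) → let open Move mv in
             tally u φ P′ + mask (u x) (φ i) + mask (u z) (φ i) ≡
             tally u φ P + mask (u x) (φ (predℤ i)) + mask (u z) (φ (sucℤ i))
tally-move {u = u} {i} {P} {P′} φ mv =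
  subst₂ (λ a b → tally u φ P′ + mask (u x) (φ a) + mask (u z) (φ b) ≡
                  tally u φ P + mask (u x) (φ (predℤ i)) + mask (u z) (φ (sucℤ i))) Px Pz
    (subst₂ (λ a b → tally u φ P′ + mask (u x) (φ (P x)) + mask (u z) (φ (P z)) ≡
                     tally u φ P + mask (u x) (φ a) + mask (u z) (φ b)) P′x P′z
      (sum-change₂ _ _ x z x≢z (λ c c≢x c≢z → cong (λ a → mask (u c) (φ a)) (fixed c c≢x c≢z))))
  where open Move mv

everyone : ∀ {n} → Colouring n
everyone _ = true

size : ∀ {n} → Colouring n → ℤ
size w = sum (λ c → mask (w c) 1ℤ)

module _ {n} (w : Colouring n) (P : Positions n) (p : ℤ) where

  -- Σ (x - p)⁺ over the selected chips, and their number at sites ≥ p and = p.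
  excess above here : ℤ
  excess = tally w (λ a → ramp (a - p)) P
  above = tally w (λ a → step (a - p)) P
  here = tally w (λ a → spike (a - p)) P

module _ {n} (w : Colouring n) (P : Positions n) where

  excess-pred : ∀ p → excess w P (predℤ p) ≡ excess w P p + above w P p
  excess-pred p = trans (tally-cong w P (λ a → trans (cong ramp (shift a p)) (ramp-suc (a - p))))
    (tally-+ w P (λ a → ramp (a - p)) (λ a → step (a - p)))
    where
    shift : ∀ a p → a - (-1ℤ + p) ≡ 1ℤ + (a - p)
    shift = solve-∀

  above-suc : ∀ p → above w P p ≡ above w P (sucℤ p) + here w P p
  above-suc p = trans (tally-cong w P (λ a → trans (step-pred (a - p)) (cong (λ b → step b + spike (a - p)) (shift a p))))
    (tally-+ w P (λ a → step (a - sucℤ p)) (λ a → spike (a - p)))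
    where
    shift : ∀ a p → -1ℤ + (a - p) ≡ a - (1ℤ + p)
    shift = solve-∀

  excess-suc : ∀ p → excess w P p ≡ excess w P (sucℤ p) + above w P (sucℤ p)
  excess-suc p = subst (λ q → excess w P q ≡ excess w P (sucℤ p) + above w P (sucℤ p)) (pred-suc p) (excess-pred (sucℤ p))

  excess-Δ : ∀ p → excess w P (predℤ p) + excess w P (sucℤ p) ≡ + 2 * excess w P p + here w P p
  excess-Δ p = linear 6 (λ a b c d e h → a :≡ b :+ d ⇒ d :≡ e :+ h ⇒ b :≡ c :+ e ⇒ a :+ c :≡ + 2 :* b :+ h)
    (excess w P (predℤ p)) (excess w P p) (excess w P (sucℤ p)) (above w P p) (above w P (sucℤ p))
    (here w P p)
    (excess-pred p) (above-suc p) (excess-suc p)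

  0≤excess : ∀ p → 0ℤ ≤ excess w P p
  0≤excess p = tally-nonneg w P (λ a → 0≤ramp (a - p))

  0≤above : ∀ p → 0ℤ ≤ above w P p
  0≤above p = tally-nonneg w P (λ a → 0≤step (a - p))

  above≤size : ∀ p → above w P p ≤ size w
  above≤size p = tally-mono w P (λ a → step≤1 (a - p))

module _ {n} {w : Colouring n} {i P P′} (u : Colouring n) (mv : Move w i P P′) where
  open Move mv

  -- Over one unit a ramp changes by a step. When x and z are both selected, the two steps differ
  -- only at p = i, which is why the excess of all chips counts firings.
  excess-move : ∀ p → excess u P′ p + mask (u x) (step (predℤ (i - p))) ≡
                excess u P p + mask (u z) (step (i - p))
  excess-move p = go (u x) (u z) (excess u P p) (excess u P′ p) (tally-move {u = u} (λ a → ramp (a - p)) mv)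
    where
    down : ramp (i - p) ≡ ramp (predℤ i - p) + step (predℤ (i - p))
    down = trans (cong ramp (sym (suc-pred (i - p))))
          (trans (ramp-suc (predℤ (i - p))) (cong (λ b → ramp b + step (predℤ (i - p))) (sym (+-assoc -1ℤ i (- p)))))
    up : ramp (sucℤ i - p) ≡ ramp (i - p) + step (i - p)
    up = trans (cong ramp (+-assoc 1ℤ i (- p))) (ramp-suc (i - p))
    go : ∀ b b′ e e′ →
         e′ + mask b (ramp (i - p)) + mask b′ (ramp (i - p)) ≡
         e + mask b (ramp (predℤ i - p)) + mask b′ (ramp (sucℤ i - p)) →
         e′ + mask b (step (predℤ (i - p))) ≡ e + mask b′ (step (i - p))
    go true true e e′ h = linear 7 (λ e e′ r d u s s′ → r :≡ d :+ s′ ⇒ u :≡ r :+ s ⇒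
      e′ :+ r :+ r :≡ e :+ d :+ u ⇒ e′ :+ s′ :≡ e :+ s)
      e e′ (ramp (i - p)) (ramp (predℤ i - p)) (ramp (sucℤ i - p)) (step (i - p)) (step (predℤ (i - p))) down up h
    go true false e e′ h = linear 5 (λ e e′ r d s′ → r :≡ d :+ s′ ⇒
      e′ :+ r :+ con 0ℤ :≡ e :+ d :+ con 0ℤ ⇒ e′ :+ s′ :≡ e :+ con 0ℤ)
      e e′ (ramp (i - p)) (ramp (predℤ i - p)) (step (predℤ (i - p))) down h
    go false true e e′ h = linear 5 (λ e e′ r u s → u :≡ r :+ s ⇒
      e′ :+ con 0ℤ :+ r :≡ e :+ con 0ℤ :+ u ⇒ e′ :+ con 0ℤ :≡ e :+ s)
      e e′ (ramp (i - p)) (ramp (sucℤ i - p)) (step (i - p)) up h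
    go false false e e′ h = linear 2 (λ e e′ → e′ :+ con 0ℤ :+ con 0ℤ :≡ e :+ con 0ℤ :+ con 0ℤ ⇒
      e′ :+ con 0ℤ :≡ e :+ con 0ℤ) e e′ h

  -- `above` is the difference of `excess` at neighbouring sites, so this is the difference of two
  -- instances of `excess-move`.
  above-move : ∀ p → above u P′ p + mask (u x) (spike (i - p)) ≡
               above u P p + mask (u z) (spike (i - predℤ p))
  above-move p = linear 10
    (λ e e⁻ a e′ e′⁻ a′ x⁻ x z⁻ z → e⁻ :≡ e :+ a ⇒ e′⁻ :≡ e′ :+ a′ ⇒
      e′ :+ x :≡ e :+ z ⇒ e′⁻ :+ (x :+ x⁻) :≡ e⁻ :+ (z :+ z⁻) ⇒ a′ :+ x⁻ :≡ a :+ z⁻)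
    (excess u P p) (excess u P (predℤ p)) (above u P p) (excess u P′ p) (excess u P′ (predℤ p))
    (above u P′ p)
    (mask (u x) (spike (i - p))) (mask (u x) (step (predℤ (i - p))))
    (mask (u z) (spike (i - predℤ p))) (mask (u z) (step (i - p)))
    (excess-pred u P p) (excess-pred u P′ p) (excess-move p)
    (subst₂ (λ a b → excess u P′ (predℤ p) + a ≡ excess u P (predℤ p) + b) down up (excess-move (predℤ p)))
    where
    shift : ∀ i p → -1ℤ + (i - (-1ℤ + p)) ≡ i - p
    shift = solve-∀
    down : mask (u x) (step (predℤ (i - predℤ p))) ≡
           mask (u x) (step (predℤ (i - p))) + mask (u x) (spike (i - p))
    down = trans (cong (λ b → mask (u x) (step b)) (shift i p))
          (trans (cong (mask (u x)) (step-pred (i - p))) (mask-+ (u x) _ _))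
    up : mask (u z) (step (i - predℤ p)) ≡ mask (u z) (step (i - p)) + mask (u z) (spike (i - predℤ p))
    up = trans (cong (mask (u z)) (step-pred (i - predℤ p)))
        (trans (mask-+ (u z) _ _) (cong (λ b → mask (u z) (step b) + mask (u z) (spike (i - predℤ p))) (shift i p)))

  -- Counted from the configuration after the move, where y is still at i while x and z have left.
  three-here : T (u x) → T (u y) → T (u z) → + 3 ≤ here u P i
  three-here ux uy uz = go (u x) (u z) ux uz (tally-move {u = u} (λ a → spike (a - i)) mv)
    where
    centre : spike (i - i) ≡ 1ℤ
    centre = cong spike (+-inverseʳ i)
    down : spike (predℤ i - i) ≡ 0ℤ
    down = cong spike (trans (+-assoc -1ℤ i (- i)) (cong predℤ (+-inverseʳ i)))
    up : spike (sucℤ i - i) ≡ 0ℤ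
    up = cong spike (trans (+-assoc 1ℤ i (- i)) (cong sucℤ (+-inverseʳ i)))
    middle : spike (i - i) ≤ here u P′ i
    middle = subst (λ a → spike (a - i) ≤ here u P′ i) P′y (tally-∋ u P′ (λ a → 0≤spike (a - i)) uy)
    go : ∀ b b′ → T b → T b′ →
         here u P′ i + mask b (spike (i - i)) + mask b′ (spike (i - i)) ≡
         here u P i + mask b (spike (predℤ i - i)) + mask b′ (spike (sucℤ i - i)) →
         + 3 ≤ here u P i
    go true true _ _ = linear 5 (λ h h′ s d u → s :≡ con 1ℤ ⇒ d :≡ con 0ℤ ⇒ u :≡ con 0ℤ ⇒ s :≤ h′ ⇒
      h′ :+ s :+ s :≡ h :+ d :+ u ⇒ con (+ 3) :≤ h)
      (here u P i) (here u P′ i) (spike (i - i)) (spike (predℤ i - i)) (spike (sucℤ i - i)) centre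
      down up middle

forget : ∀ {n} {w : Colouring n} {i P P′} → Move w i P P′ → Move everyone i P P′
forget mv = record { Move mv ; z⇒y = id ; y⇒x = id }

tally-origin : ∀ {n} (w : Colouring n) {P} φ → (∀ c → P c ≡ 0ℤ) → tally w φ P ≡ size w * φ 0ℤ
tally-origin w φ P≡0 = trans (sum-cong-≗ λ c → trans (cong (λ a → mask (w c) (φ a)) (P≡0 c)) (mask-* (w c) (φ 0ℤ)))
                             (sym (*-distribʳ-sum (φ 0ℤ) (λ c → mask (w c) 1ℤ)))
  where
  mask-* : ∀ b a → mask b a ≡ mask b 1ℤ * a
  mask-* true a = sym (*-identityˡ a)
  mask-* false a = refl

excess-origin : ∀ {n} (w : Colouring n) {P} p → (∀ c → P c ≡ 0ℤ) → excess w P p ≡ size w * ramp (- p)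
excess-origin w p P≡0 = trans (tally-origin w (λ a → ramp (a - p)) P≡0) (cong (λ b → size w * ramp b) (+-identityˡ (- p)))

-- A firing that would push the excess at i over the barrier needs more than two selected
-- chips above those that the curvature of the barrier leaves at i.
barrier-move : ∀ {n} {w : Colouring n} {i P P′} H s → s ≤ + 2 * H → Move w i P P′ →
               (∀ p → excess w P p ≤ barrier H s p) → ∀ p → excess w P′ p ≤ barrier H s p
barrier-move {w = w} {i} {P} {P′} H s s≤2H mv below p =
  go (w x) (w z) refl refl (excess-move w mv p)
  where
  open Move mv
  go : ∀ b b′ → w x ≡ b → w z ≡ b′ →
       excess w P′ p + mask b (step (predℤ (i - p))) ≡ excess w P p + mask b′ (step (i - p)) →
       excess w P′ p ≤ barrier H s p
  go true false _ _ h = linear 4 (λ e e′ s F → e :≤ F ⇒ con 0ℤ :≤ s ⇒ e′ :+ s :≡ e :+ con 0ℤ ⇒ e′ :≤ F)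
    (excess w P p) (excess w P′ p) (step (predℤ (i - p))) (barrier H s p) (below p) (0≤step _) h
  go false false _ _ h = linear 3 (λ e e′ F → e :≤ F ⇒ e′ :+ con 0ℤ :≡ e :+ con 0ℤ ⇒ e′ :≤ F)
    (excess w P p) (excess w P′ p) (barrier H s p) (below p) h
  go false true wx wz _ = ⊥-elim (subst T wx (y⇒x (z⇒y (subst T (sym wz) tt))))
  go true true wx wz h with i ≟ p
  ... | no i≢p = linear 6 (λ e e′ s s′ k F → e :≤ F ⇒ s :≡ s′ :+ k ⇒ k :≡ con 0ℤ ⇒ e′ :+ s′ :≡ e :+ s ⇒ e′ :≤ F)
    (excess w P p) (excess w P′ p) (step (i - p)) (step (predℤ (i - p))) (spike (i - p)) (barrier H s p)
    (below p) (step-pred (i - p)) (spike-≢ (i≢p ∘ i-j≡0⇒i≡j i p)) h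
  ... | yes refl = linear 12
    (λ e e′ e₋ e₊ s s′ k F F₋ F₊ c ĥ → e₋ :≤ F₋ ⇒ e₊ :≤ F₊ ⇒ F₋ :+ F₊ :≡ + 2 :* F :+ c ⇒
      c :≤ con (+ 2) ⇒
      e₋ :+ e₊ :≡ + 2 :* e :+ ĥ ⇒ con (+ 3) :≤ ĥ ⇒ s :≡ s′ :+ k ⇒ k :≡ con 1ℤ ⇒ e′ :+ s′ :≡ e :+ s ⇒ e′ :≤ F)
    (excess w P i) (excess w P′ i) (excess w P (predℤ i)) (excess w P (sucℤ i))
    (step (i - i)) (step (predℤ (i - i))) (spike (i - i))
    (barrier H s i) (barrier H s (predℤ i)) (barrier H s (sucℤ i)) (curvature H s i) (here w P i)
    (below (predℤ i)) (below (sucℤ i)) (barrier-Δ H s i) (curvature-≤2 H s i s≤2H)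
    (excess-Δ w P i)
    (three-here w mv (subst T (sym wx) tt) (z⇒y (subst T (sym wz) tt)) (subst T (sym wz) tt))
    (step-pred (i - i)) (cong spike (+-inverseʳ i)) h

barrier-origin : ∀ {n} (w : Colouring n) {P} H → (∀ c → P c ≡ 0ℤ) → ∀ p → excess w P p ≤ barrier H (size w) p
barrier-origin w {P} H P≡0 p = linear 3 (λ e r q → e :≡ r ⇒ con 0ℤ :≤ q ⇒ e :≤ r :+ q)
  (excess w P p) (size w * ramp (- p)) (quarter (H - + 2 * + ∣ p ∣)) (excess-origin w p P≡0) (0≤quarter (H - + 2 * + ∣ p ∣))

-- Chips that fire from i end up next to i, so a later firing elsewhere does not involve them.
Move-swap : ∀ {n} {w : Colouring n} {i j P P₁ P₂} → Move w i P P₁ → Move w j P₁ P₂ →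
            j ≢ i → j ≢ predℤ i → j ≢ sucℤ i → ∃ λ Q → Move w j P Q × Move w i Q P₂
Move-swap {n} {w} {i} {j} {P} {P₁} {P₂} m₁ m₂ j≢i j≢i-1 j≢i+1 = Q ,
  record { x = B.x ; y = B.y ; z = B.z ; Px = from B.Px ; Py = from B.Py ; Pz = from B.Pz
         ; x≢y = B.x≢y ; y≢z = B.y≢z ; x≢z = B.x≢z ; P′x = Qx ; P′z = Qz ; fixed = Q-fixed
         ; z⇒y = B.z⇒y ; y⇒x = B.y⇒x } ,
  record { x = A.x ; y = A.y ; z = A.z
         ; Px = trans (unmoved x-apart) A.Px ; Py = trans (unmoved y-apart) A.Py ; Pz = trans (unmoved z-apart) A.Pz
         ; x≢y = A.x≢y ; y≢z = A.y≢z ; x≢z = A.x≢z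
         ; P′x = trans (B.fixed A.x (x-apart B.Px) (x-apart B.Pz)) A.P′x
         ; P′z = trans (B.fixed A.z (z-apart B.Px) (z-apart B.Pz)) A.P′z
         ; fixed = P₂-fixed ; z⇒y = A.z⇒y ; y⇒x = A.y⇒x }
  where
  module A = Move m₁
  module B = Move m₂
  x-apart : ∀ {c} → P₁ c ≡ j → A.x ≢ c
  x-apart P₁c refl = j≢i-1 (trans (sym P₁c) A.P′x)
  y-apart : ∀ {c} → P₁ c ≡ j → A.y ≢ c
  y-apart P₁c refl = j≢i (trans (sym P₁c) A.P′y)
  z-apart : ∀ {c} → P₁ c ≡ j → A.z ≢ c
  z-apart P₁c refl = j≢i+1 (trans (sym P₁c) A.P′z)
  from : ∀ {c} → P₁ c ≡ j → P c ≡ j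
  from P₁c = trans (sym (A.fixed _ (x-apart P₁c ∘ sym) (z-apart P₁c ∘ sym))) P₁c
  Q₁ Q : Positions n
  Q₁ = updateAt P B.x (const (predℤ j))
  Q = updateAt Q₁ B.z (const (sucℤ j))
  Q-fixed : ∀ c → c ≢ B.x → c ≢ B.z → Q c ≡ P c
  Q-fixed c c≢x c≢z = trans (updateAt-minimal c B.z Q₁ c≢z) (updateAt-minimal c B.x P c≢x)
  Qx : Q B.x ≡ predℤ j
  Qx = trans (updateAt-minimal B.x B.z Q₁ B.x≢z) (updateAt-updates B.x P)
  Qz : Q B.z ≡ sucℤ j
  Qz = updateAt-updates B.z Q₁
  unmoved : ∀ {c} → (∀ {c′} → P₁ c′ ≡ j → c ≢ c′) → Q c ≡ P c
  unmoved apart = Q-fixed _ (apart B.Px) (apart B.Pz)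
  P₂-fixed : ∀ c → c ≢ A.x → c ≢ A.z → P₂ c ≡ Q c
  P₂-fixed c c≢x c≢z with c ≟ᶠ B.x | c ≟ᶠ B.z
  ... | yes refl | _ = trans B.P′x (sym Qx)
  ... | no _ | yes refl = trans B.P′z (sym Qz)
  ... | no c≢x′ | no c≢z′ =
    trans (B.fixed c c≢x′ c≢z′) (trans (A.fixed c c≢x c≢z) (sym (Q-fixed c c≢x′ c≢z′)))

mirror : ∀ {n} → Positions n → Positions n
mirror P c = - P c

neg-predℤ : ∀ i → - predℤ i ≡ sucℤ (- i)
neg-predℤ i = neg-distrib-+ -1ℤ i

neg-sucℤ : ∀ i → - sucℤ i ≡ predℤ (- i)
neg-sucℤ i = neg-distrib-+ 1ℤ i

-- Reflection exchanges x and z and so reverses the order of the chips; the complement of a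
-- down-closed set is down-closed for the reversed order.
Move-mirror : ∀ {n} {w : Colouring n} {i P P′} → Move w i P P′ → Move (not ∘ w) (- i) (mirror P) (mirror P′)
Move-mirror {w = w} {i} mv = record
  { x = z ; y = y ; z = x ; Px = cong -_ Pz ; Py = cong -_ Py ; Pz = cong -_ Px
  ; x≢y = y≢z ∘ sym ; y≢z = x≢y ∘ sym ; x≢z = x≢z ∘ sym
  ; P′x = trans (cong -_ P′z) (neg-sucℤ i) ; P′z = trans (cong -_ P′x) (neg-predℤ i)
  ; fixed = λ c c≢z c≢x → cong -_ (fixed c c≢x c≢z)
  ; z⇒y = contra (w y) (w x) y⇒x ; y⇒x = contra (w z) (w y) z⇒y }
  where
  open Move mv
  contra : ∀ b b′ → (T b → T b′) → T (not b′) → T (not b)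
  contra false _ _ _ = tt
  contra true false f _ = f tt
  contra true true _ ()

module _ {n} (w : Colouring n) (P : Positions n) where

  excess-anti : ∀ {p q} → p ≤ q → excess w P q ≤ excess w P p
  excess-anti p≤q = tally-mono w P (λ a → ramp-mono (+-monoʳ-≤ a (neg-mono-≤ p≤q)))

  above-anti : ∀ {p q} → p ≤ q → above w P q ≤ above w P p
  above-anti p≤q = tally-mono w P (λ a → step-mono (+-monoʳ-≤ a (neg-mono-≤ p≤q)))

  tally≤everyone : ∀ {φ} → (∀ a → 0ℤ ≤ φ a) → tally w φ P ≤ tally everyone φ P
  tally≤everyone {φ} 0≤φ = linear 3 (λ a b c → a :+ b :≡ c ⇒ con 0ℤ :≤ b ⇒ a :≤ c)
    (tally w φ P) (tally (not ∘ w) φ P) (tally everyone φ P) (tally-not w P φ)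
    (tally-nonneg (not ∘ w) P 0≤φ)

  -- The mirrored site is at least 1 - p exactly when the original one is at most p - 1.
  above-mirror : ∀ p → above w P p + above w (mirror P) (1ℤ - p) ≡ size w
  above-mirror p = trans (sym (∑-distrib-+ (λ c → mask (w c) (step (P c - p))) (λ c → mask (w c) (step (- P c - (1ℤ - p))))))
    (sum-cong-≗ (λ c → trans (sym (mask-+ (w c) (step (P c - p)) (step (- P c - (1ℤ - p))))) (cong (mask (w c))
      (trans (cong (λ b → step (P c - p) + step b) (shift (P c) p)) (step-reflect (P c - p))))))
    where
    shift : ∀ a p → - a - (1ℤ - p) ≡ -1ℤ - (a - p)
    shift = solve-∀

  above-∋ : ∀ {c p} → T (w c) → p ≤ P c → 1ℤ ≤ above w P p
  above-∋ {c} {p} wc p≤Pc = subst (_≤ above w P p) (step-pos (i≤j⇒0≤j-i p≤Pc)) (tally-∋ w P (λ a → 0≤step (a - p)) wc)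

-- Firing counts on a half-line

module Half (M : ℤ) where

  -- For r k the number of remaining firings at distance k from 0: a descent by more than one, or
  -- an ascent, can only occur where r has not yet come down to the line M - k.
  record Tame (r : ℕ → ℤ) : Set where
    constructor _,_
    field
      slope : ∀ k → r k ≤ 1ℤ + r (suc k) ⊎ M ≤ r (suc k) + + suc k
      rise : ∀ k → r (suc k) ≤ r k ⊎ M ≤ r k

  open Tame

  Tame-cong : ∀ {r r′} → (∀ k → r′ k ≡ r k) → Tame r → Tame r′
  Tame-cong {r} {r′} r′≡r t = slope′ , rise′
    where
    slope′ : ∀ k → r′ k ≤ 1ℤ + r′ (suc k) ⊎ M ≤ r′ (suc k) + + suc k
    slope′ k rewrite r′≡r k | r′≡r (suc k) = slope t k
    rise′ : ∀ k → r′ (suc k) ≤ r′ k ⊎ M ≤ r′ k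
    rise′ k rewrite r′≡r k | r′≡r (suc k) = rise t k

  -- By the strict concavity `fire`, a descent of more than one into the firing site forces such a
  -- descent out of it, and an ascent out of it forces an ascent into it. The threshold known on
  -- that other side then passes to the firing site: inwards for `slope`, outwards for `rise`.
  Tame-fire : ∀ {r r′} j → Tame r → r j + r (suc (suc j)) + 1ℤ ≤ + 2 * r (suc j) →
              1ℤ + r′ (suc j) ≡ r (suc j) → (∀ k → k ≢ suc j → r′ k ≡ r k) → Tame r′
  Tame-fire {r} {r′} j t fire drop same = slope′ , rise′
    where
    slope′ : ∀ k → r′ k ≤ 1ℤ + r′ (suc k) ⊎ M ≤ r′ (suc k) + + suc k
    slope′ k with k ℕₚ.≟ suc j | k ℕₚ.≟ j
    ... | yes refl | _ rewrite same (suc (suc j)) ℕₚ.1+n≢n with slope t (suc j)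
    ...   | inj₁ h = inj₁ (linear 3 (λ a a′ b → a :≤ con 1ℤ :+ b ⇒ con 1ℤ :+ a′ :≡ a ⇒ a′ :≤ con 1ℤ :+ b)
                       (r (suc j)) (r′ (suc j)) (r (suc (suc j))) h drop)
    ...   | inj₂ h = inj₂ h
    slope′ k | no _ | yes refl rewrite same j (ℕₚ.1+n≢n ∘ sym) with r j ≤? r (suc j) | slope t (suc j)
    ...   | yes h | _ = inj₁ (subst (r j ≤_) (sym drop) h)
    ...   | no h | inj₁ h′ = ⊥-elim (h (linear 3
              (λ a b c → a :+ c :+ con 1ℤ :≤ + 2 :* b ⇒ b :≤ con 1ℤ :+ c ⇒ a :≤ b)
              (r j) (r (suc j)) (r (suc (suc j))) fire h′))
    ...   | no h | inj₂ h′ = inj₂ (linear 6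
              (λ a b b′ c M j → a :+ c :+ con 1ℤ :≤ + 2 :* b ⇒ con 1ℤ :+ b :≤ a ⇒
                M :≤ c :+ (con (+ 2) :+ j) ⇒ con 1ℤ :+ b′ :≡ b ⇒ M :≤ b′ :+ (con 1ℤ :+ j))
              (r j) (r (suc j)) (r′ (suc j)) (r (suc (suc j))) M (+ j) fire (i<j⇒suc[i]≤j (≰⇒> h)) h′
              drop)
    slope′ k | no k≢1+j | no k≢j
      rewrite same k k≢1+j | same (suc k) (k≢j ∘ ℕₚ.suc-injective) = slope t k

    rise′ : ∀ k → r′ (suc k) ≤ r′ k ⊎ M ≤ r′ k
    rise′ k with k ℕₚ.≟ suc j | k ℕₚ.≟ j
    ... | yes refl | _ rewrite same (suc (suc j)) ℕₚ.1+n≢n with r (suc (suc j)) ≤? r′ (suc j) | rise t j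
    ...   | yes h | _ = inj₁ h
    ...   | no h | inj₁ h′ = ⊥-elim (h (linear 4
              (λ a b b′ c → a :+ c :+ con 1ℤ :≤ + 2 :* b ⇒ b :≤ a ⇒ con 1ℤ :+ b′ :≡ b ⇒ c :≤ b′)
              (r j) (r (suc j)) (r′ (suc j)) (r (suc (suc j))) fire h′ drop))
    ...   | no h | inj₂ h′ = inj₂ (linear 5
              (λ a b b′ c M → a :+ c :+ con 1ℤ :≤ + 2 :* b ⇒ M :≤ a ⇒ con 1ℤ :+ b′ :≡ b ⇒
                con 1ℤ :+ b′ :≤ c ⇒ M :≤ b′)
              (r j) (r (suc j)) (r′ (suc j)) (r (suc (suc j))) M fire h′ drop (i<j⇒suc[i]≤j (≰⇒> h)))
    rise′ k | no _ | yes refl rewrite same j (ℕₚ.1+n≢n ∘ sym) with rise t j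
    ...   | inj₁ h = inj₁ (linear 3 (λ a b b′ → b :≤ a ⇒ con 1ℤ :+ b′ :≡ b ⇒ b′ :≤ a)
                       (r j) (r (suc j)) (r′ (suc j)) h drop)
    ...   | inj₂ h = inj₂ h
    rise′ k | no k≢1+j | no k≢j
      rewrite same k k≢1+j | same (suc k) (k≢j ∘ ℕₚ.suc-injective) = rise t k

  -- Ascents originate at 0: r can rise there only if l falls by more than one, and the threshold of
  -- l at distance 1 turns into M at 0. It travels outwards unchanged, hence the constant M in
  -- `rise`.
  Tame-fire₀ : ∀ {r l r′} → Tame r → Tame l → l 0 ≡ r 0 → r 1 + l 1 + + 2 ≤ + 2 * r 0 →
               1ℤ + r′ 0 ≡ r 0 → (∀ k → r′ (suc k) ≡ r (suc k)) → Tame r′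
  Tame-fire₀ {r} {l} {r′} t tₗ l≡r fire drop same = slope′ , rise′
    where
    slope′ : ∀ k → r′ k ≤ 1ℤ + r′ (suc k) ⊎ M ≤ r′ (suc k) + + suc k
    slope′ zero rewrite same 0 with slope t 0
    ... | inj₁ h = inj₁ (linear 3 (λ a a′ b → a :≤ con 1ℤ :+ b ⇒ con 1ℤ :+ a′ :≡ a ⇒ a′ :≤ con 1ℤ :+ b)
                     (r 0) (r′ 0) (r 1) h drop)
    ... | inj₂ h = inj₂ h
    slope′ (suc k) rewrite same k | same (suc k) = slope t (suc k)
    rise′ : ∀ k → r′ (suc k) ≤ r′ k ⊎ M ≤ r′ k
    rise′ zero rewrite same 0 with r 1 ≤? r′ 0 | slope tₗ 0
    ... | yes h | _ = inj₁ h
    ... | no h | inj₁ h′ = ⊥-elim (h (linear 5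
            (λ a a′ b c d → d :≡ a ⇒ b :+ c :+ con (+ 2) :≤ + 2 :* a ⇒ d :≤ con 1ℤ :+ c ⇒
              con 1ℤ :+ a′ :≡ a ⇒ b :≤ a′)
            (r 0) (r′ 0) (r 1) (l 1) (l 0) l≡r fire h′ drop))
    ... | no h | inj₂ h′ = inj₂ (linear 5
            (λ a a′ b c M → b :+ c :+ con (+ 2) :≤ + 2 :* a ⇒ M :≤ c :+ con 1ℤ ⇒
              con 1ℤ :+ a′ :≡ a ⇒ con 1ℤ :+ a′ :≤ b ⇒ M :≤ a′)
            (r 0) (r′ 0) (r 1) (l 1) M fire h′ drop (i<j⇒suc[i]≤j (≰⇒> h)))
    rise′ (suc k) rewrite same k | same (suc k) = rise t (suc k)

  -- On or below the line, both alternatives of tameness yield the same inequality, and `fire`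
  -- leaves no room beyond equality.
  Tame-end : ∀ {r} j → Tame r → r j + r (suc (suc j)) + 1ℤ ≤ + 2 * r (suc j) →
             r (suc j) + + suc j ≤ M → r j ≡ r (suc j) × 1ℤ + r (suc (suc j)) ≡ r (suc j)
  Tame-end {r} j t fire end with flat | level
    where
    flat : r (suc j) ≤ 1ℤ + r (suc (suc j))
    flat with slope t (suc j)
    ... | inj₁ h = h
    ... | inj₂ h = linear 4 (λ b c M j → b :+ (con 1ℤ :+ j) :≤ M ⇒ M :≤ c :+ (con (+ 2) :+ j) ⇒
      b :≤ con 1ℤ :+ c)
                     (r (suc j)) (r (suc (suc j))) M (+ j) end h
    level : r (suc j) ≤ r j
    level with rise t j
    ... | inj₁ h = h
    ... | inj₂ h = linear 4 (λ a b M j → b :+ (con 1ℤ :+ j) :≤ M ⇒ M :≤ a ⇒ con 0ℤ :≤ j ⇒ b :≤ a)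
                     (r j) (r (suc j)) M (+ j) end h (+≤+ z≤n)
  ... | flat | level =
    linear 3 (λ a b c → b :≤ con 1ℤ :+ c ⇒ b :≤ a ⇒ a :+ c :+ con 1ℤ :≤ + 2 :* b ⇒ a :≡ b)
      (r j) (r (suc j)) (r (suc (suc j))) flat level fire ,
    linear 3 (λ a b c → b :≤ con 1ℤ :+ c ⇒ b :≤ a ⇒ a :+ c :+ con 1ℤ :≤ + 2 :* b ⇒ con 1ℤ :+ c :≡ b)
      (r j) (r (suc j)) (r (suc (suc j))) flat level fire

  Tame-end₀ : ∀ {r} → Tame r → r 0 ≤ M → r 0 ≤ 1ℤ + r 1
  Tame-end₀ {r} t end with slope t 0
  ... | inj₁ h = h
  ... | inj₂ h = linear 3 (λ a b M → a :≤ M ⇒ M :≤ b :+ con 1ℤ ⇒ a :≤ con 1ℤ :+ b) (r 0) (r 1) M end h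

-- The self-loop path with 4M - 1 chips

module Firing {n} (M : ℤ) (1≤M : 1ℤ ≤ M) (chips : size {n} everyone ≡ + 4 * M - 1ℤ) where

  open Half M
  open Tame

  private
    H N : ℤ
    H = + 2 * M
    N = + 4 * M - 1ℤ

  -- The number of firings at p that are still to come.
  remaining : Positions n → ℤ → ℤ
  remaining P p = barrier H N p - excess everyone P p

  remaining-Δ : ∀ P p → remaining P (predℤ p) + remaining P (sucℤ p) + here everyone P p ≡
                + 2 * remaining P p + curvature H N p
  remaining-Δ P p = linear 8 (λ F₋ F F₊ e₋ e e₊ c h → F₋ :+ F₊ :≡ + 2 :* F :+ c ⇒ e₋ :+ e₊ :≡ + 2 :* e :+ h ⇒
      (F₋ :- e₋) :+ (F₊ :- e₊) :+ h :≡ + 2 :* (F :- e) :+ c)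
    (barrier H N (predℤ p)) (barrier H N p) (barrier H N (sucℤ p))
    (excess everyone P (predℤ p)) (excess everyone P p) (excess everyone P (sucℤ p))
    (curvature H N p) (here everyone P p) (barrier-Δ H N p) (excess-Δ everyone P p)

  curvature-≤ : ∀ p → curvature H N p ≤ + 2
  curvature-≤ p = curvature-≤2 H N p (linear 1 (λ M → + 4 :* M :- con 1ℤ :≤ + 2 :* (+ 2 :* M)) M)

  -- 4M - 1 - 2 (2M - 1) = 1. The barrier leaves one chip at 0 instead of two, so firing there gives
  -- concavity 2, as `Tame-fire₀` requires.
  curvature-0 : curvature H N 0ℤ ≡ 1ℤ
  curvature-0 = linear 2 (λ M r → r :≡ con -1ℤ :+ + 2 :* M ⇒ + 4 :* M :- con 1ℤ :- + 2 :* r :≡ con 1ℤ)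
    M (ramp (predℤ H)) (ramp-pos (linear 1 (λ M → con 1ℤ :≤ M ⇒ con 0ℤ :≤ con -1ℤ :+ + 2 :* M) M 1≤M))

  module _ {w : Colouring n} {i P P′} (mv : Move w i P P′) where

    remaining-move : ∀ p → remaining P′ p + spike (i - p) ≡ remaining P p
    remaining-move p = linear 6 (λ e e′ s s′ k F → e′ :+ s′ :≡ e :+ s ⇒ s :≡ s′ :+ k ⇒
      (F :- e′) :+ k :≡ F :- e)
      (excess everyone P p) (excess everyone P′ p) (step (i - p)) (step (predℤ (i - p)))
      (spike (i - p)) (barrier H N p)
      (excess-move everyone mv p) (step-pred (i - p))

    remaining-i : 1ℤ + remaining P′ i ≡ remaining P i
    remaining-i = trans (+-comm 1ℤ (remaining P′ i))
      (subst (λ k → remaining P′ i + k ≡ remaining P i) (cong spike (+-inverseʳ i)) (remaining-move i))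

    remaining-≢ : ∀ {p} → i ≢ p → remaining P′ p ≡ remaining P p
    remaining-≢ {p} i≢p = trans (sym (+-identityʳ _))
      (subst (λ k → remaining P′ p + k ≡ remaining P p) (spike-≢ (i≢p ∘ i-j≡0⇒i≡j i p)) (remaining-move p))

    firing : remaining P (predℤ i) + remaining P (sucℤ i) + + 3 ≤ + 2 * remaining P i + curvature H N i
    firing = linear 5 (λ a b c d h → a :+ b :+ h :≡ + 2 :* c :+ d ⇒ con (+ 3) :≤ h ⇒
      a :+ b :+ con (+ 3) :≤ + 2 :* c :+ d)
      (remaining P (predℤ i)) (remaining P (sucℤ i)) (remaining P i) (curvature H N i)
      (here everyone P i)
      (remaining-Δ P i) (three-here everyone mv tt tt tt)

    firing-≢0 : remaining P (predℤ i) + remaining P (sucℤ i) + 1ℤ ≤ + 2 * remaining P i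
    firing-≢0 = linear 4 (λ a b c d → a :+ b :+ con (+ 3) :≤ + 2 :* c :+ d ⇒ d :≤ con (+ 2) ⇒
      a :+ b :+ con 1ℤ :≤ + 2 :* c)
      (remaining P (predℤ i)) (remaining P (sucℤ i)) (remaining P i) (curvature H N i) firing
      (curvature-≤ i)

  right left : (ℤ → ℤ) → ℕ → ℤ
  right v k = v (+ k)
  left v k = v (- + k)

  Regular : Positions n → Set
  Regular P = Tame (right (remaining P)) × Tame (left (remaining P))

  firing₀ : ∀ {w P P′} → Move w 0ℤ P P′ → remaining P 1ℤ + remaining P -1ℤ + + 2 ≤ + 2 * remaining P 0ℤ
  firing₀ {P = P} mv = linear 4 (λ a b c d → a :+ b :+ con (+ 3) :≤ + 2 :* c :+ d ⇒ d :≡ con 1ℤ ⇒ b :+ a :+ con (+ 2) :≤ + 2 :* c)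
    (remaining P -1ℤ) (remaining P 1ℤ) (remaining P 0ℤ) (curvature H N 0ℤ) (firing mv) curvature-0

  firing⁻ : ∀ {w P P′} j → Move w -[1+ j ] P P′ →
            left (remaining P) j + left (remaining P) (suc (suc j)) + 1ℤ ≤ + 2 * left (remaining P) (suc j)
  firing⁻ {P = P} j mv = subst (λ q → remaining P q + remaining P -[1+ suc j ] + 1ℤ ≤ + 2 * remaining P -[1+ j ])
    (sucℤ-neg j)
    (subst (λ t → t + 1ℤ ≤ + 2 * remaining P -[1+ j ]) (+-comm (remaining P -[1+ suc j ]) _) (firing-≢0 mv))

  Regular-move : ∀ {w i P P′} → Move w i P P′ → Regular P → Regular P′
  Regular-move {i = + 0} {P} mv (tᵣ , tₗ) =
    Tame-fire₀ tᵣ tₗ refl (firing₀ mv) (remaining-i mv) (λ k → remaining-≢ mv {+[1+ k ]} λ ()) ,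
    Tame-fire₀ tₗ tᵣ refl
      (subst (λ t → t + + 2 ≤ + 2 * remaining P 0ℤ) (+-comm (remaining P 1ℤ) (remaining P -1ℤ)) (firing₀ mv))
      (remaining-i mv) (λ k → remaining-≢ mv { -[1+ k ]} λ ())
  Regular-move {i = +[1+ j ]} mv (tᵣ , tₗ) =
    Tame-fire j tᵣ (firing-≢0 mv) (remaining-i mv) (λ k k≢ → remaining-≢ mv (k≢ ∘ sym ∘ +-injective)) ,
    Tame-cong (λ k → remaining-≢ mv (pos≢neg k)) tₗ
    where
    pos≢neg : ∀ k → +[1+ j ] ≢ - + k
    pos≢neg zero ()
    pos≢neg (suc _) ()
  Regular-move {i = -[1+ j ]} mv (tᵣ , tₗ) =
    Tame-cong (λ k → remaining-≢ mv {+ k} λ ()) tᵣ ,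
    Tame-fire j tₗ (firing⁻ j mv) (remaining-i mv) (λ k k≢ → remaining-≢ mv (k≢ ∘ neg≡ k))
    where
    neg≡ : ∀ k → -[1+ j ] ≡ - + k → k ≡ suc j
    neg≡ (suc k) refl = refl

  -- Late firings

  Late : Positions n → ℤ → Set
  Late P p = remaining P p + + ∣ p ∣ ≤ M

  Early : Positions n → ℤ → Set
  Early P p = ¬ Late P p

  -- `step i` is 1 exactly when `sucℤ i` is farther from 0 than i, and `step (- i)` does the same
  -- for `predℤ i`; the count falls by one outwards and stays level inwards.
  late-neighbours : ∀ {w i P P′} → Move w i P P′ → Regular P → Late P i →
    remaining P (sucℤ i) + step i ≡ remaining P i × remaining P (predℤ i) + step (- i) ≡ remaining P i
  late-neighbours {i = + 0} {P} mv (tᵣ , tₗ) late =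
    linear 3 solution (remaining P 0ℤ) (remaining P 1ℤ) (remaining P -1ℤ) atᵣ atₗ (firing₀ mv) ,
    linear 3 solution (remaining P 0ℤ) (remaining P -1ℤ) (remaining P 1ℤ) atₗ atᵣ
      (subst (λ t → t + + 2 ≤ + 2 * remaining P 0ℤ) (+-comm (remaining P 1ℤ) (remaining P -1ℤ)) (firing₀ mv))
    where
    solution : Expr 3 → Expr 3 → Expr 3 → Problem 3
    solution a b c = a :≤ con 1ℤ :+ b ⇒ a :≤ con 1ℤ :+ c ⇒ b :+ c :+ con (+ 2) :≤ + 2 :* a ⇒ b :+ con 1ℤ :≡ a
    late′ : remaining P 0ℤ ≤ M
    late′ = subst (_≤ M) (+-identityʳ (remaining P 0ℤ)) late
    atᵣ : remaining P 0ℤ ≤ 1ℤ + remaining P 1ℤ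
    atᵣ = Tame-end₀ tᵣ late′
    atₗ : remaining P 0ℤ ≤ 1ℤ + remaining P -1ℤ
    atₗ = Tame-end₀ tₗ late′
  late-neighbours {i = +[1+ j ]} {P} mv (tᵣ , _) late =
    trans (+-comm (remaining P (+ suc (suc j))) 1ℤ) (proj₂ (Tame-end j tᵣ (firing-≢0 mv) late)) ,
    trans (+-identityʳ (remaining P (+ j))) (proj₁ (Tame-end j tᵣ (firing-≢0 mv) late))
  late-neighbours {i = -[1+ j ]} {P} mv (_ , tₗ) late =
    trans (+-identityʳ (remaining P (sucℤ -[1+ j ])))
      (trans (cong (remaining P) (sucℤ-neg j)) (proj₁ (Tame-end j tₗ (firing⁻ j mv) late))) ,
    trans (+-comm (remaining P -[1+ suc j ]) 1ℤ) (proj₂ (Tame-end j tₗ (firing⁻ j mv) late))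

  module _ {w i P P′} (mv : Move w i P P′) (reg : Regular P) (late : Late P i) where

    -- By `remaining-Δ` the number of chips is the curvature plus the two steps: 1 + 1 + 1 at 0, and
    -- elsewhere at most 2 plus the single outward step.
    late-here : here everyone P i ≤ + 3
    late-here with late-neighbours mv reg late
    ... | eqₛ , eqₚ = linear 7
      (λ a b v s s′ c h → b :+ s :≡ v ⇒ a :+ s′ :≡ v ⇒ a :+ b :+ h :≡ + 2 :* v :+ c ⇒
        c :+ s :+ s′ :≤ con (+ 3) ⇒ h :≤ con (+ 3))
      (remaining P (predℤ i)) (remaining P (sucℤ i)) (remaining P i) (step i) (step (- i))
      (curvature H N i) (here everyone P i)
      eqₛ eqₚ (remaining-Δ P i) (total i)
      where
      total : ∀ i → curvature H N i + step i + step (- i) ≤ + 3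
      total (+ 0) = ≤-reflexive (cong (λ c → c + 1ℤ + 1ℤ) curvature-0)
      total +[1+ k ] = linear 1 (λ c → c :≤ con (+ 2) ⇒
        c :+ con 1ℤ :+ con 0ℤ :≤ con (+ 3)) (curvature H N +[1+ k ]) (curvature-≤ +[1+ k ])
      total -[1+ k ] = linear 1 (λ c → c :≤ con (+ 2) ⇒
        c :+ con 0ℤ :+ con 1ℤ :≤ con (+ 3)) (curvature H N -[1+ k ]) (curvature-≤ -[1+ k ])

    -- Outwards, the lost firing pays for the greater distance; inwards, the distance shrinks at an
    -- equal count.
    late-suc : Late P (sucℤ i)
    late-suc = linear 6 (λ v v′ s a a′ M → v′ :+ s :≡ v ⇒ a′ :≤ a :+ s ⇒ v :+ a :≤ M ⇒ v′ :+ a′ :≤ M)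
      (remaining P i) (remaining P (sucℤ i)) (step i) (+ ∣ i ∣) (+ ∣ sucℤ i ∣) M
      (proj₁ (late-neighbours mv reg late)) (abs i) late
      where
      abs : ∀ i → + ∣ sucℤ i ∣ ≤ + ∣ i ∣ + step i
      abs (+ k) = ≤-reflexive (+-comm 1ℤ (+ k))
      abs -[1+ zero ] = +≤+ z≤n
      abs -[1+ suc k ] = linear 1 (λ k → con 1ℤ :+ k :≤ con (+ 2) :+ k :+ con 0ℤ) (+ k)

    late-pred : Late P (predℤ i)
    late-pred = linear 6 (λ v v′ s a a′ M → v′ :+ s :≡ v ⇒ a′ :≤ a :+ s ⇒ v :+ a :≤ M ⇒ v′ :+ a′ :≤ M)
      (remaining P i) (remaining P (predℤ i)) (step (- i)) (+ ∣ i ∣) (+ ∣ predℤ i ∣) M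
      (proj₂ (late-neighbours mv reg late)) (abs i) late
      where
      abs : ∀ i → + ∣ predℤ i ∣ ≤ + ∣ i ∣ + step (- i)
      abs (+ 0) = ≤-refl
      abs +[1+ k ] = linear 1 (λ k → k :≤ con 1ℤ :+ k :+ con 0ℤ) (+ k)
      abs -[1+ k ] = ≤-reflexive (+-comm 1ℤ +[1+ k ])

  remaining-≤ : ∀ {w i P P′} → Move w i P P′ → ∀ p → remaining P′ p ≤ remaining P p
  remaining-≤ {i = i} {P} {P′} mv p = linear 3 (λ a b k → b :+ k :≡ a ⇒ con 0ℤ :≤ k ⇒ b :≤ a)
    (remaining P p) (remaining P′ p) (spike (i - p)) (remaining-move mv p) (0≤spike (i - p))

  Late-move : ∀ {w i P P′} → Move w i P P′ → ∀ p → Late P p → Late P′ p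
  Late-move mv p = ≤-trans (+-monoˡ-≤ (+ ∣ p ∣) (remaining-≤ mv p))

  Late-resp : ∀ {P P′ p} → remaining P′ p ≡ remaining P p → Late P p → Late P′ p
  Late-resp {p = p} eq = subst (λ v → v + + ∣ p ∣ ≤ M) (sym eq)

  -- Postponing late firings

  module _ (w : Colouring n) where

    data Step (K : Positions n → ℤ → Set) (P P′ : Positions n) : Set where
      at : ∀ i → K P i → Move w i P P′ → Step K P P′

    EarlyStep LateStep : Positions n → Positions n → Set
    EarlyStep = Step Early
    LateStep = Step Late

    -- The neighbours of a site that fires late are late too, so an early firing that follows
    -- a late one happens at distance at least two from it.
    commute : ∀ {P P₁ P₂} → Regular P → LateStep P P₁ → EarlyStep P₁ P₂ →
              ∃ λ Q → EarlyStep P Q × LateStep Q P₂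
    commute {P} {P₁} {P₂} reg (at i late m₁) (at j early m₂) =
      finish (Move-swap m₁ m₂ (apart late) (apart (late-pred m₁ reg late)) (apart (late-suc m₁ reg late)))
      where
      apart : ∀ {p} → Late P p → j ≢ p
      apart late-p refl = early (Late-move m₁ j late-p)
      finish : (∃ λ Q → Move w j P Q × Move w i Q P₂) → ∃ λ Q → EarlyStep P Q × LateStep Q P₂
      finish (Q , m₂′ , m₁′) = Q , at j (early ∘ Late-move m₁ j) m₂′ ,
        at i (Late-resp {P} {Q} (remaining-≢ m₂′ (apart late)) late) m₁′

    Regular-step : ∀ {K P P′} → Step K P P′ → Regular P → Regular P′
    Regular-step (at _ _ mv) = Regular-move mv

    push : ∀ {P P₁ P₂} → Regular P → LateStep P P₁ → Star EarlyStep P₁ P₂ →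
           ∃ λ Q → Star EarlyStep P Q × LateStep Q P₂
    push reg l ε = _ , ε , l
    push reg l (e ◅ es) =
      let Q , e′ , l′ = commute reg l e
          Q′ , es′ , l″ = push (Regular-step e′ reg) l′ es
      in Q′ , e′ ◅ es′ , l″

    late? : ∀ P p → Dec (Late P p)
    late? P p = remaining P p + + ∣ p ∣ ≤? M

    -- Insertion into the reordered rest of the run: an early move goes in front, a late one is
    -- pushed past the early block.
    reorder : ∀ {P P′} → Regular P → Star (AnyMove w) P P′ → ∃ λ Q → Star EarlyStep P Q × Star LateStep Q P′
    reorder reg ε = _ , ε , ε
    reorder {P} {P′} reg ((i , mv) ◅ run) = insert (late? P i) (reorder (Regular-move mv reg) run)
      where
      insert : Dec (Late P i) → (∃ λ Q → Star EarlyStep _ Q × Star LateStep Q P′) →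
               ∃ λ Q → Star EarlyStep P Q × Star LateStep Q P′
      insert (no early) (Q , es , ls) = Q , at i early mv ◅ es , ls
      insert (yes late) (Q , es , ls) =
        let Q′ , es′ , l = push reg (at i late mv) es in Q′ , es′ , l ◅ ls

  -- quarter (Y + 1) = Y + (Y - 2) + (Y - 4) + … is the least excess of Y chips
  -- that sit at most two to a site.
  spread : ∀ {u : Colouring n} {P H₁ s} → (∀ q → 1ℤ ≤ q → sucℤ q ≤ M → here everyone P q ≤ + 2) →
           excess everyone P (predℤ M) ≤ 0ℤ → (∀ p → excess u P p ≤ barrier H₁ s p) →
           ∀ p → 1ℤ ≤ p → above u P p ≤ ramp (H₁ - + 2 * p + 1ℤ)
  spread {u} {P} {H₁} {s} crowd empty below = bound
    where
    e a : ℤ → ℤ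
    e = excess u P
    a = above u P
    e≤0 : ∀ {p} → M ≤ p → e (predℤ p) ≤ 0ℤ
    e≤0 {p} M≤p = ≤-trans (tally≤everyone u P (λ b → 0≤ramp (b - predℤ p)))
                 (≤-trans (excess-anti everyone P (pred-mono M≤p)) empty)
    a≤0 : ∀ {p} → M ≤ p → a p ≤ 0ℤ
    a≤0 {p} M≤p = linear 3 (λ e₋ e a → e₋ :≡ e :+ a ⇒ e₋ :≤ con 0ℤ ⇒ con 0ℤ :≤ e ⇒ a :≤ con 0ℤ)
      (e (predℤ p)) (e p) (a p) (excess-pred u P p) (e≤0 M≤p) (0≤excess u P p)
    -- Induction on the distance to M, where no chips are left. At most two chips per site means
    -- that `a` falls by at most two from p to `sucℤ p`, which matches `quarter-step`.
    lower : ∀ j p → M ≤ p + + j → 1ℤ ≤ p → quarter (1ℤ + a p) ≤ e (predℤ p)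
    lower j p M≤p+j 1≤p with M ≤? p
    ... | yes M≤p = ≤-trans (quarter-mono (+-monoʳ-≤ 1ℤ (a≤0 M≤p))) (0≤excess u P (predℤ p))
    lower zero p M≤p+0 1≤p | no M≰p = ⊥-elim (M≰p (subst (M ≤_) (+-identityʳ p) M≤p+0))
    lower (suc j) p M≤p+j 1≤p | no M≰p =
      linear 7 (λ e₋ e a q₊ q₋ q r → e₋ :≡ e :+ a ⇒ q₊ :≡ q₋ :+ r ⇒ r :≡ a ⇒ q₋ :≤ q ⇒ q :≤ e ⇒
        q₊ :≤ e₋)
        (e (predℤ p)) (e p) (a p) (quarter (1ℤ + a p)) (quarter (1ℤ + a p - + 2))
        (quarter (1ℤ + a (sucℤ p))) (ramp (1ℤ + a p - 1ℤ))
        (excess-pred u P p) (quarter-step (1ℤ + a p))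
        (trans (cong ramp (cancel (a p))) (ramp-pos (0≤above u P p)))
        (quarter-mono (linear 3 (λ a a₊ h → a :≡ a₊ :+ h ⇒ h :≤ con (+ 2) ⇒ con 1ℤ :+ a :- con (+ 2) :≤ con 1ℤ :+ a₊)
          (a p) (a (sucℤ p)) (here u P p) (above-suc u P p)
          (≤-trans (tally≤everyone u P (λ b → 0≤spike (b - p))) (crowd p 1≤p (i<j⇒suc[i]≤j (≰⇒> M≰p))))))
        (subst (λ q → quarter (1ℤ + a (sucℤ p)) ≤ e q) (pred-suc p)
          (lower j (sucℤ p) (subst (M ≤_) (shift p (+ j)) M≤p+j) (≤-trans 1≤p (i≤suc[i] p))))
      where
      cancel : ∀ y → 1ℤ + y - 1ℤ ≡ y
      cancel = solve-∀
      shift : ∀ p j → p + (1ℤ + j) ≡ 1ℤ + p + j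
      shift = solve-∀
    bound : ∀ p → 1ℤ ≤ p → a p ≤ ramp (H₁ - + 2 * p + 1ℤ)
    bound (+ 0) (+≤+ ())
    bound p@(+[1+ k ]) 1≤p with a p ≤? H₁ - + 2 * p + 1ℤ | 1ℤ ≤? a p
    ... | yes a≤ | _ = ≤-trans a≤ (a≤ramp _)
    ... | no _ | no a<1 = ≤-trans (linear 1 (λ a → con 1ℤ :+ a :≤ con 1ℤ ⇒ a :≤ con 0ℤ) (a p) (i<j⇒suc[i]≤j (≰⇒> a<1))) (0≤ramp _)
    -- If the bound failed, the least excess of `a p` chips, measured at k = p - 1, would exceed the
    -- barrier there, which for k ≥ 0 is `quarter (H₁ - 2k)`.
    ... | no a> | yes 1≤a = ⊥-elim (contradict
          (quarter-strict 1≤a (linear 3 (λ a h k → con 1ℤ :+ (h :- + 2 :* (con 1ℤ :+ k) :+ con 1ℤ) :≤ a ⇒ h :- + 2 :* k :≤ a)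
            (a p) H₁ (+ k) (i<j⇒suc[i]≤j (≰⇒> a>))))
          (lower (∣ M ∣) p (subst (_≤ p + + ∣ M ∣) (trans (+-identityˡ (+ ∣ M ∣)) (0≤i⇒+∣i∣≡i (≤-trans (+≤+ z≤n) 1≤M)))
            (+-monoˡ-≤ (+ ∣ M ∣) (≤-trans (+≤+ z≤n) 1≤p))) 1≤p)
          (below (+ k)))
      where
      contradict : 1ℤ + quarter (H₁ - + 2 * + k) ≤ quarter (1ℤ + a p) → quarter (1ℤ + a p) ≤ e (+ k) →
                   e (+ k) ≤ barrier H₁ s (+ k) → ⊥
      contradict lo mid hi rewrite ramp-nonpos (neg-mono-≤ (+≤+ (z≤n {k}))) =
        1≰0 (linear 4 (λ q q′ e z → con 1ℤ :+ q :≤ q′ ⇒ q′ :≤ e ⇒ e :≤ z :+ q ⇒ z :≡ con 0ℤ ⇒ con 1ℤ :≤ con 0ℤ)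
          (quarter (H₁ - + 2 * + k)) (quarter (1ℤ + a p)) (e (+ k)) (s * 0ℤ) lo mid hi (*-zeroʳ s))

  -- Bound on the number of selected chips at or right of p during the late phase, when at
  -- most k of them end at or right of - r.
  slack : ℤ → Positions n → ℤ → ℤ
  slack r P p = remaining P p - r + ramp (- p) + ramp (- r - p)

  Sifted : Colouring n → ℤ → ℤ → Positions n → Set
  Sifted w r k P = ∀ p → above w P p ≤ k + ramp (slack r P p)

  module _ {w : Colouring n} {i P P′} (r k : ℤ) (mv : Move w i P P′) (reg : Regular P) (late : Late P i) where
    open Move mv

    private
      β β⁺ : ℤ
      β = slack r P i
      β⁺ = slack r P (sucℤ i)

      drop₁ : ∀ b → ramp (predℤ b) ≤ ramp b × ramp b ≤ 1ℤ + ramp (predℤ b)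
      drop₁ (+ 0) = ≤-refl , +≤+ z≤n
      drop₁ +[1+ n ] = linear 1 (λ n → n :≤ con 1ℤ :+ n) (+ n) , ≤-refl
      drop₁ -[1+ _ ] = ≤-refl , +≤+ z≤n

      shift : ∀ r i → -1ℤ + (- r - i) ≡ - r - (1ℤ + i)
      shift = solve-∀

      -- From i to `sucℤ i` the sum of `remaining` and `ramp (- p)` falls by exactly one, and the
      -- ramp anchored at - r by zero or one. A fall of at least one serves firings without coloured
      -- chips; a fall of at most two serves those with three.
      β⁺<β : 1ℤ + β⁺ ≤ β
      β⁺<β = linear 8 (λ v v⁺ s a a⁺ b b⁺ r → v⁺ :+ s :≡ v ⇒ a :+ s :≡ a⁺ :+ con 1ℤ ⇒ b⁺ :≤ b ⇒
          con 1ℤ :+ (v⁺ :- r :+ a⁺ :+ b⁺) :≤ v :- r :+ a :+ b)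
        (remaining P i) (remaining P (sucℤ i)) (step i) (ramp (- i)) (ramp (- sucℤ i))
        (ramp (- r - i)) (ramp (- r - sucℤ i)) r
        (proj₁ (late-neighbours mv reg late)) (ramp-neg-suc i)
        (subst (λ b → ramp b ≤ ramp (- r - i)) (shift r i) (proj₁ (drop₁ (- r - i))))

      β≤β⁺+2 : β ≤ + 2 + β⁺
      β≤β⁺+2 = linear 8 (λ v v⁺ s a a⁺ b b⁺ r → v⁺ :+ s :≡ v ⇒ a :+ s :≡ a⁺ :+ con 1ℤ ⇒
        b :≤ con 1ℤ :+ b⁺ ⇒
          v :- r :+ a :+ b :≤ con (+ 2) :+ (v⁺ :- r :+ a⁺ :+ b⁺))
        (remaining P i) (remaining P (sucℤ i)) (step i) (ramp (- i)) (ramp (- sucℤ i))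
        (ramp (- r - i)) (ramp (- r - sucℤ i)) r
        (proj₁ (late-neighbours mv reg late)) (ramp-neg-suc i)
        (subst (λ b → ramp (- r - i) ≤ 1ℤ + ramp b) (shift r i) (proj₂ (drop₁ (- r - i))))

    Sifted-move : Sifted w r k P → Sifted w r k P′
    Sifted-move sifted p = by-site (i ≟ p) (sucℤ i ≟ p)
      where
      slack-≢ : ∀ {p} → i ≢ p → slack r P′ p ≡ slack r P p
      slack-≢ {p} i≢p = cong (λ v → v - r + ramp (- p) + ramp (- r - p)) (remaining-≢ mv i≢p)

      at-i : above w P′ i ≤ k + ramp (slack r P′ i)
      at-i = by-colour (w x) (w z) refl refl (above-move w mv i)
        where
        β′≡ : 1ℤ + slack r P′ i ≡ β
        β′≡ = linear 5 (λ v v′ r a b → con 1ℤ :+ v′ :≡ v ⇒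
          con 1ℤ :+ (v′ :- r :+ a :+ b) :≡ v :- r :+ a :+ b)
          (remaining P i) (remaining P′ i) r (ramp (- i)) (ramp (- r - i)) (remaining-i mv)
        pred-i : ∀ i → i - (-1ℤ + i) ≡ 1ℤ
        pred-i = solve-∀
        by-colour : ∀ b b′ → w x ≡ b → w z ≡ b′ →
          above w P′ i + mask b (spike (i - i)) ≡ above w P i + mask b′ (spike (i - predℤ i)) →
          above w P′ i ≤ k + ramp (slack r P′ i)
        -- A coloured chip leaves to the left, so the count falls together with the bound.
        by-colour true b′ _ _ h = linear 7 (λ a a′ s s′ k β β′ → s :≡ con 1ℤ ⇒ s′ :≡ con 0ℤ ⇒
          a′ :+ s :≡ a :+ s′ ⇒
            a :≤ k :+ β ⇒ β :≤ con 1ℤ :+ β′ ⇒ a′ :≤ k :+ β′)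
          (above w P i) (above w P′ i) (spike (i - i)) (mask b′ (spike (i - predℤ i))) k (ramp β)
          (ramp (slack r P′ i))
          (cong spike (+-inverseʳ i)) (trans (cong (λ c → mask b′ (spike c)) (pred-i i)) (mask-0 b′))
          h (sifted i)
          (subst (λ b → ramp β ≤ 1ℤ + ramp b) (trans (cong predℤ (sym β′≡)) (pred-suc (slack r P′ i))) (proj₂ (drop₁ β)))
          where
          mask-0 : ∀ b → mask b 0ℤ ≡ 0ℤ
          mask-0 true = refl
          mask-0 false = refl
        by-colour false true wx wz _ = ⊥-elim (subst T wx (y⇒x (z⇒y (subst T (sym wz) tt))))
        -- Exactly three chips are at i and none is coloured, so the counts at i and `sucℤ i` agree,
        -- and the old bound at `sucℤ i` is within the new one at i.
        by-colour false false wx wz h = linear 9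
          (λ a a′ a⁺ h o t k β⁺ β′ → a′ :+ con 0ℤ :≡ a :+ con 0ℤ ⇒ a :≡ a⁺ :+ h ⇒ h :+ o :≡ t ⇒
            t :≤ con (+ 3) ⇒ con (+ 3) :≤ o ⇒
            a⁺ :≤ k :+ β⁺ ⇒ β⁺ :≤ β′ ⇒ a′ :≤ k :+ β′)
          (above w P i) (above w P′ i) (above w P (sucℤ i)) (here w P i) (here (not ∘ w) P i)
          (here everyone P i) k (ramp β⁺) (ramp (slack r P′ i))
          h (above-suc w P i) (tally-not w P (λ a → spike (a - i))) (late-here mv reg late)
          (three-here (not ∘ w) mv (uncoloured wx) (uncoloured wy) (uncoloured wz))
          (sifted (sucℤ i))
          (ramp-mono (linear 3 (λ b b⁺ b′ → con 1ℤ :+ b⁺ :≤ b ⇒ con 1ℤ :+ b′ :≡ b ⇒ b⁺ :≤ b′) β β⁺ (slack r P′ i) β⁺<β β′≡))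
          where
          uncoloured : ∀ {c} → w c ≡ false → T (not (w c))
          uncoloured eq = subst (T ∘ not) (sym eq) tt
          wy : w y ≡ false
          wy = off (w y) (subst T wx ∘ y⇒x)
            where
            off : ∀ b → ¬ T b → b ≡ false
            off true ¬t = ⊥-elim (¬t tt)
            off false _ = refl

      at-suc : above w P′ (sucℤ i) ≤ k + ramp (slack r P′ (sucℤ i))
      at-suc = subst (λ b → above w P′ (sucℤ i) ≤ k + ramp b) (sym (slack-≢ (i≢suc[i] {i})))
        (by-colour (w x) (w z) refl refl (above-move w mv (sucℤ i)))
        where
        off : ∀ i → i - (1ℤ + i) ≡ -1ℤ
        off = solve-∀
        on : ∀ i → i - (-1ℤ + (1ℤ + i)) ≡ 0ℤ
        on = solve-∀
        untouched : ∀ b → mask b (spike (i - sucℤ i)) ≡ 0ℤ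
        untouched true = cong spike (off i)
        untouched false = refl
        by-colour : ∀ b b′ → w x ≡ b → w z ≡ b′ →
          above w P′ (sucℤ i) + mask b (spike (i - sucℤ i)) ≡ above w P (sucℤ i) + mask b′ (spike (i - predℤ (sucℤ i))) →
          above w P′ (sucℤ i) ≤ k + ramp β⁺
        by-colour b false _ _ h = linear 5 (λ a a′ s k β → s :≡ con 0ℤ ⇒ a′ :+ s :≡ a :+ con 0ℤ ⇒
          a :≤ k :+ β ⇒ a′ :≤ k :+ β)
          (above w P (sucℤ i)) (above w P′ (sucℤ i)) (mask b (spike (i - sucℤ i))) k (ramp β⁺)
          (untouched b) h (sifted (sucℤ i))
        -- All three fired chips are coloured, so the count at `sucℤ i` was at least three below
        -- that at i and gains only one.
        by-colour b true _ wz h = linear 9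
          (λ a a⁺ a⁺′ s s′ h k β β⁺ → s :≡ con 0ℤ ⇒ s′ :≡ con 1ℤ ⇒ a⁺′ :+ s :≡ a⁺ :+ s′ ⇒
            a :≡ a⁺ :+ h ⇒ con (+ 3) :≤ h ⇒
            a :≤ k :+ β ⇒ β :≤ con (+ 2) :+ β⁺ ⇒ a⁺′ :≤ k :+ β⁺)
          (above w P i) (above w P (sucℤ i)) (above w P′ (sucℤ i)) (mask b (spike (i - sucℤ i)))
          (spike (i - predℤ (sucℤ i)))
          (here w P i) k (ramp β) (ramp β⁺)
          (untouched b) (cong spike (on i)) h (above-suc w P i)
          (three-here w mv (y⇒x (z⇒y wz′)) (z⇒y wz′) wz′) (sifted i) (two-lipschitz (ramp-cases β))
          where
          wz′ : T (w z)
          wz′ = subst T (sym wz) tt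
          two-lipschitz : ramp β ≡ β × 0ℤ ≤ β ⊎ ramp β ≡ 0ℤ × β ≤ -1ℤ → ramp β ≤ + 2 + ramp β⁺
          two-lipschitz (inj₁ (eq , _)) = linear 4 (λ R b b⁺ R⁺ → R :≡ b ⇒ b :≤ con (+ 2) :+ b⁺ ⇒
            b⁺ :≤ R⁺ ⇒ R :≤ con (+ 2) :+ R⁺)
            (ramp β) β β⁺ (ramp β⁺) eq β≤β⁺+2 (a≤ramp β⁺)
          two-lipschitz (inj₂ (eq , _)) = linear 2 (λ R R⁺ → R :≡ con 0ℤ ⇒ con 0ℤ :≤ R⁺ ⇒
            R :≤ con (+ 2) :+ R⁺)
            (ramp β) (ramp β⁺) eq (0≤ramp β⁺)

      by-site : Dec (i ≡ p) → Dec (sucℤ i ≡ p) → above w P′ p ≤ k + ramp (slack r P′ p)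
      by-site (yes refl) _ = at-i
      by-site (no _) (yes refl) = at-suc
      by-site (no i≢p) (no i+1≢p) = subst (λ b → above w P′ p ≤ k + ramp b) (sym (slack-≢ i≢p))
        (subst (_≤ k + ramp (slack r P p)) (sym same) (sifted p))
        where
        mask-spike : ∀ b {a} → a ≢ 0ℤ → mask b (spike a) ≡ 0ℤ
        mask-spike true = spike-≢
        mask-spike false _ = refl
        same : above w P′ p ≡ above w P p
        same = linear 4 (λ a a′ s s′ → s :≡ con 0ℤ ⇒ s′ :≡ con 0ℤ ⇒ a′ :+ s :≡ a :+ s′ ⇒ a′ :≡ a)
          (above w P p) (above w P′ p) (mask (w x) (spike (i - p))) (mask (w z) (spike (i - predℤ p)))
          (mask-spike (w x) (i≢p ∘ i-j≡0⇒i≡j i p))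
          (mask-spike (w z) (λ eq → i+1≢p (trans (cong sucℤ (i-j≡0⇒i≡j i (predℤ p) eq)) (suc-pred p))))
          (above-move w mv p)

  Sifted-late : ∀ {w P P′} r k → Regular P → Star (LateStep w) P P′ → Sifted w r k P → Sifted w r k P′
  Sifted-late r k reg ε sifted = sifted
  Sifted-late {w} r k reg (at i late mv ◅ run) sifted =
    Sifted-late r k (Regular-move mv reg) run (Sifted-move r k mv reg late sifted)

  -- Invariants of runs from the origin

  record Reachable (w : Colouring n) (P : Positions n) : Set where
    field
      regular : Regular P
      0≤remaining : ∀ p → 0ℤ ≤ remaining P p
      remaining≤ : ∀ p → remaining P p ≤ quarter (H - + 2 * + ∣ p ∣)
      -- By `barrier-neg` this amounts to Σ x = 0: firing keeps the centre of mass at 0.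
      symmetric : ∀ p → remaining (mirror P) p ≡ remaining P (- p)
      below : ∀ h → size w ≤ + 2 * h → ∀ p → excess w P p ≤ barrier h (size w) p
      below-mirror : ∀ h → size (not ∘ w) ≤ + 2 * h →
                     ∀ p → excess (not ∘ w) (mirror P) p ≤ barrier h (size (not ∘ w)) p

  open Reachable

  -- (M - |p|)² ≥ M - |p| for |p| ≤ M, so the firing counts start on or above the line.
  parabola : ∀ p → M ≤ quarter (H - + 2 * + ∣ p ∣) + + ∣ p ∣
  parabola p = linear 3 (λ M a q → M :- a :≤ q ⇒ M :≤ q :+ a) M (+ ∣ p ∣) (quarter (H - + 2 * + ∣ p ∣))
    (subst (λ k → M - + ∣ p ∣ ≤ quarter k) (distrib M (+ ∣ p ∣)) (a≤quarter[2a] (M - + ∣ p ∣)))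
    where
    distrib : ∀ M a → + 2 * (M - a) ≡ + 2 * M - + 2 * a
    distrib = solve-∀

  remaining-origin : ∀ {P} → (∀ c → P c ≡ 0ℤ) → ∀ p → remaining P p ≡ quarter (H - + 2 * + ∣ p ∣)
  remaining-origin {P} P≡0 p = linear 3 (λ e t q → e :≡ t ⇒ (t :+ q) :- e :≡ q)
    (excess everyone P p) (N * ramp (- p)) (quarter (H - + 2 * + ∣ p ∣))
    (trans (excess-origin everyone p P≡0) (cong (_* ramp (- p)) chips))

  remaining-nonneg : ∀ {P} → (∀ p → excess everyone P p ≤ barrier H N p) → ∀ p → 0ℤ ≤ remaining P p
  remaining-nonneg excess≤ p = i≤j⇒0≤j-i (excess≤ p)

  Reachable-origin : ∀ {w P} → (∀ c → P c ≡ 0ℤ) → Reachable w P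
  Reachable-origin {w} {P} P≡0 = record
    { regular = (slope₀ +_ (λ _ → refl) , rise₀ +_ (λ _ → refl)) ,
                (slope₀ (λ k → - + k) ∣-∣ , rise₀ (λ k → - + k) ∣-∣)
    ; 0≤remaining = λ p → subst (0ℤ ≤_) (sym (origin p)) (0≤quarter (H - + 2 * + ∣ p ∣))
    ; remaining≤ = λ p → ≤-reflexive (origin p)
    ; symmetric = λ p → trans (remaining-origin (λ c → cong -_ (P≡0 c)) p)
        (trans (cong (λ k → quarter (H - + 2 * + k)) (sym (∣-i∣≡∣i∣ p))) (sym (origin (- p))))
    ; below = λ h _ → barrier-origin w h P≡0
    ; below-mirror = λ h _ → barrier-origin (not ∘ w) h (λ c → cong -_ (P≡0 c))
    }
    where
    origin : ∀ p → remaining P p ≡ quarter (H - + 2 * + ∣ p ∣)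
    origin = remaining-origin P≡0
    ∣-∣ : ∀ k → ∣ - + k ∣ ≡ k
    ∣-∣ k = ∣-i∣≡∣i∣ (+ k)
    -- The initial parabola is steep, but it nowhere lies below the line, so the second alternative
    -- holds throughout.
    slope₀ : ∀ (f : ℕ → ℤ) → (∀ k → ∣ f k ∣ ≡ k) → ∀ k → remaining P (f k) ≤ 1ℤ + remaining P (f (suc k)) ⊎
            M ≤ remaining P (f (suc k)) + + suc k
    slope₀ f ∣f∣ k = inj₂ (subst (M ≤_) (cong₂ (λ v a → v + + a) (sym (origin (f (suc k)))) (∣f∣ (suc k))) (parabola (f (suc k))))
    rise₀ : ∀ (f : ℕ → ℤ) → (∀ k → ∣ f k ∣ ≡ k) → ∀ k → remaining P (f (suc k)) ≤ remaining P (f k) ⊎ M ≤ remaining P (f k)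
    rise₀ f ∣f∣ k = inj₁ (subst₂ _≤_
      (trans (cong (λ a → quarter (H - + 2 * + a)) (sym (∣f∣ (suc k)))) (sym (origin (f (suc k)))))
      (trans (cong (λ a → quarter (H - + 2 * + a)) (sym (∣f∣ k))) (sym (origin (f k))))
      (quarter-mono (linear 2 (λ H k → H :- + 2 :* (con 1ℤ :+ k) :≤ H :- + 2 :* k) H (+ k))))

  Reachable-move : ∀ {w i P P′} → Move w i P P′ → Reachable w P → Reachable w P′
  Reachable-move {w} {i} {P} {P′} mv ρ = record
    { regular = Regular-move mv (regular ρ)
    ; 0≤remaining = remaining-nonneg {P′} (barrier-move H N (linear 1 (λ M → + 4 :* M :- con 1ℤ :≤ + 2 :* (+ 2 :* M)) M)
        (forget mv) (λ p → 0≤i-j⇒j≤i (0≤remaining ρ p)))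
    ; remaining≤ = λ p → ≤-trans (remaining-≤ mv p) (remaining≤ ρ p)
    ; symmetric = λ p → linear 6 (λ a a′ b b′ s t → a′ :+ s :≡ a ⇒ b′ :+ t :≡ b ⇒ s :≡ t ⇒ a :≡ b ⇒
      a′ :≡ b′)
        (remaining (mirror P) p) (remaining (mirror P′) p) (remaining P (- p)) (remaining P′ (- p))
        (spike (- i - p)) (spike (i - - p)) (remaining-move (Move-mirror mv) p)
        (remaining-move mv (- p))
        (trans (cong spike (flip i p)) (spike-neg (i - - p))) (symmetric ρ p)
    ; below = λ h s≤2h → barrier-move h (size w) s≤2h mv (below ρ h s≤2h)
    ; below-mirror = λ h s≤2h → barrier-move h (size (not ∘ w)) s≤2h (Move-mirror mv) (below-mirror ρ h s≤2h)
    }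
    where
    flip : ∀ i p → - i - p ≡ - (i - - p)
    flip = solve-∀

  Reachable-run : ∀ {w P P′} → Star (AnyMove w) P P′ → Reachable w P → Reachable w P′
  Reachable-run ε ρ = ρ
  Reachable-run ((i , mv) ◅ run) ρ = Reachable-run run (Reachable-move mv ρ)

  Reachable-early : ∀ {w P P′} → Star (EarlyStep w) P P′ → Reachable w P → Reachable w P′
  Reachable-early ε ρ = ρ
  Reachable-early (at i _ mv ◅ run) ρ = Reachable-early run (Reachable-move mv ρ)

  -- An early firing starts strictly above the line and lowers the count by one.
  early-keeps : ∀ {w P P′} → Star (EarlyStep w) P P′ → ∀ p → M ≤ remaining P p + + ∣ p ∣ → M ≤ remaining P′ p + + ∣ p ∣
  early-keeps ε p h = h
  early-keeps {P = P} (_◅_ {j = P₁} (at i early mv) run) p h = early-keeps run p (keep (i ≟ p))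
    where
    keep : Dec (i ≡ p) → M ≤ remaining P₁ p + + ∣ p ∣
    keep (yes refl) = linear 4 (λ v v′ a M → con 1ℤ :+ v′ :≡ v ⇒ con 1ℤ :+ M :≤ v :+ a ⇒ M :≤ v′ :+ a)
      (remaining P i) (remaining P₁ i) (+ ∣ i ∣) M (remaining-i mv) (i<j⇒suc[i]≤j (≰⇒> early))
    keep (no i≢p) = subst (λ v → M ≤ v + + ∣ p ∣) (sym (remaining-≢ mv i≢p)) h

  -- Late firings make no site late: the one that fires was late already, and the others keep their
  -- counts.
  late-before : ∀ {w P P′} → Star (LateStep w) P P′ → ∀ p → Late P′ p → Late P p
  late-before ε p h = h
  late-before {P = P} (_◅_ {j = P₁} (at i late mv) run) p h = keep (i ≟ p)
    where
    keep : Dec (i ≡ p) → Late P p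
    keep (yes refl) = late
    keep (no i≢p) = Late-resp {P₁} {P} (sym (remaining-≢ mv i≢p)) (late-before run p h)

  -- Three chips at 0 and two at each site p with 0 < |p| < M.
  Critical : Positions n → Set
  Critical P = ∀ p → + ∣ p ∣ ≤ M → remaining P p + + ∣ p ∣ ≡ M

  excess⁺ : ∀ {P} j → excess everyone P (+ j) ≡ quarter (H - + 2 * + j) - remaining P (+ j)
  excess⁺ {P} j rewrite ramp-nonpos (neg-mono-≤ (+≤+ (z≤n {j}))) =
    linear 3 (λ z q e → z :≡ con 0ℤ ⇒ e :≡ q :- (z :+ q :- e))
      (N * 0ℤ) (quarter (H - + 2 * + j)) (excess everyone P (+ j)) (*-zeroʳ N)

  -- Serves two states: with counts on the line it gives 2 (M - j - 1) chips right of j, with no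
  -- firing left one more.
  above⁺ : ∀ {P} j → + suc j ≤ M →
           above everyone P (+ suc j) + remaining P (+ j) ≡ + 2 * (M - + suc j) + 1ℤ + remaining P (+ suc j)
  above⁺ {P} j 1+j≤M = linear 10
    (λ e e′ a q q′ r v v′ M j → e :≡ e′ :+ a ⇒ e :≡ q :- v ⇒ e′ :≡ q′ :- v′ ⇒ q :≡ q′ :+ r ⇒
      r :≡ + 2 :* M :- + 2 :* j :- con 1ℤ ⇒ a :+ v :≡ + 2 :* (M :- (con 1ℤ :+ j)) :+ con 1ℤ :+ v′)
    (excess everyone P (+ j)) (excess everyone P (+ suc j)) (above everyone P (+ suc j))
    (quarter (H - + 2 * + j)) (quarter (H - + 2 * + suc j)) (ramp (H - + 2 * + j - 1ℤ))
    (remaining P (+ j)) (remaining P (+ suc j)) M (+ j)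
    (excess-pred everyone P (+ suc j)) (excess⁺ {P} j) (excess⁺ {P} (suc j))
    (trans (quarter-step (H - + 2 * + j)) (cong (λ k → quarter k + ramp (H - + 2 * + j - 1ℤ)) (shift H (+ j))))
    (ramp-pos (linear 2 (λ M j → con 1ℤ :+ j :≤ M ⇒ con 0ℤ :≤ + 2 :* M :- + 2 :* j :- con 1ℤ) M (+ j) 1+j≤M))
    where
    shift : ∀ H j → H - + 2 * j - + 2 ≡ H - + 2 * (1ℤ + j)
    shift = solve-∀

  Critical-mirror : ∀ {w P} → Reachable w P → Critical P → Critical (mirror P)
  Critical-mirror {P = P} ρ crit p p≤M = trans (cong (_+ + ∣ p ∣) (symmetric ρ p))
    (subst (λ a → remaining P (- p) + + a ≡ M) (∣-i∣≡∣i∣ p) (crit (- p) (subst (λ a → + a ≤ M) (sym (∣-i∣≡∣i∣ p)) p≤M)))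

  Critical-crowd : ∀ {P} → Critical P → ∀ q → 1ℤ ≤ q → sucℤ q ≤ M → here everyone P q ≤ + 2
  Critical-crowd crit (+ 0) (+≤+ ())
  Critical-crowd {P} crit q@(+[1+ j ]) _ q<M = linear 7
    (λ v₋ v v₊ h c M j → v₋ :+ v₊ :+ h :≡ + 2 :* v :+ c ⇒ c :≤ con (+ 2) ⇒ v₋ :+ j :≡ M ⇒
      v :+ (con 1ℤ :+ j) :≡ M ⇒ v₊ :+ (con (+ 2) :+ j) :≡ M ⇒ h :≤ con (+ 2))
    (remaining P (+ j)) (remaining P q) (remaining P (sucℤ q)) (here everyone P q) (curvature H N q) M
    (+ j)
    (remaining-Δ P q) (curvature-≤ q)
    (crit (+ j) (≤-trans (linear 1 (λ j → j :≤ con (+ 2) :+ j) (+ j)) q<M))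
    (crit q (≤-trans (i≤suc[i] q) q<M)) (crit (sucℤ q) q<M)

  Critical-empty : ∀ {P} → Critical P → excess everyone P (predℤ M) ≤ 0ℤ
  Critical-empty {P} crit = go (predℤ M) (suc-pred M) (pred-mono 1≤M)
    where
    go : ∀ p → sucℤ p ≡ M → 0ℤ ≤ p → excess everyone P p ≤ 0ℤ
    go (+ j) 1+j≡M _ = linear 5 (λ e q v M j → e :≡ q :- v ⇒ q :≡ con 1ℤ ⇒ v :+ j :≡ M ⇒
      con 1ℤ :+ j :≡ M ⇒ e :≤ con 0ℤ)
      (excess everyone P (+ j)) (quarter (H - + 2 * + j)) (remaining P (+ j)) M (+ j)
      (excess⁺ {P} j)
      (trans (cong (λ M → quarter (+ 2 * M - + 2 * + j)) (sym 1+j≡M)) (cong quarter (two (+ j))))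
      (crit (+ j) (subst (+ j ≤_) 1+j≡M (i≤suc[i] (+ j)))) 1+j≡M
      where
      two : ∀ j → + 2 * (1ℤ + j) - + 2 * j ≡ + 2
      two = solve-∀

  flip-suc : ∀ j → 1ℤ - - + j ≡ + suc j
  flip-suc j = cong sucℤ (neg-involutive (+ j))

  0≤size : ∀ (w : Colouring n) → 0ℤ ≤ size w
  0≤size w = tally-nonneg w (λ _ → 0ℤ) {λ _ → 1ℤ} (λ _ → +≤+ z≤n)

  complement : ∀ (w : Colouring n) → size w + size (not ∘ w) ≡ + 4 * M - 1ℤ
  complement w = trans (tally-not w (λ _ → 0ℤ) (λ _ → 1ℤ)) chips

  -- Coloured chips in the critical state

  module _ {w P} (ρ : Reachable w P) (crit : Critical P) (r : ℕ) (k : ℤ)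
           (r<M : + suc r ≤ M) (0≤k : 0ℤ ≤ k) (small : size w ≤ + 2 * (M - + r) - 1ℤ + k) where

    private
      nw : Colouring n
      nw = not ∘ w
      h₁ h₂ : ℤ
      h₁ = proj₁ (half-up (0≤size w))
      h₂ = proj₁ (half-up (0≤size nw))

      -- 2 h₁ ≤ 2 (M - r) + k, so `spread` allows at most k + M - r - 2p + 1 coloured chips if this
      -- is not negative; p ≥ 1 brings it below k plus the slack M - r - p.
      sifted⁺ : ∀ j → above w P +[1+ j ] ≤ k + ramp (slack (+ r) P +[1+ j ])
      sifted⁺ j = by-cases (ramp-cases (h₁ - + 2 * p + 1ℤ)) (p ≤? M)
        where
        p : ℤ
        p = +[1+ j ]
        bound : above w P p ≤ ramp (h₁ - + 2 * p + 1ℤ)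
        bound = spread {w} {P} {h₁} {size w} (Critical-crowd {P} crit) (Critical-empty {P} crit)
          (below ρ h₁ (proj₁ (proj₂ (half-up (0≤size w))))) p (+≤+ (s≤s z≤n))
        by-cases : ramp (h₁ - + 2 * p + 1ℤ) ≡ h₁ - + 2 * p + 1ℤ × 0ℤ ≤ h₁ - + 2 * p + 1ℤ ⊎
                   ramp (h₁ - + 2 * p + 1ℤ) ≡ 0ℤ × h₁ - + 2 * p + 1ℤ ≤ -1ℤ →
                   Dec (p ≤ M) → above w P p ≤ k + ramp (slack (+ r) P p)
        by-cases (inj₂ (eq , _)) _ = linear 4 (λ a R k S → a :≤ R ⇒ R :≡ con 0ℤ ⇒ con 0ℤ :≤ k ⇒
          con 0ℤ :≤ S ⇒ a :≤ k :+ S)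
          (above w P p) (ramp (h₁ - + 2 * p + 1ℤ)) k (ramp (slack (+ r) P p)) bound eq 0≤k
          (0≤ramp (slack (+ r) P p))
        by-cases (inj₁ (eq , _)) (yes p≤M) = linear 12
          (λ a R h s M r k v b c j S → a :≤ R ⇒ R :≡ h :- + 2 :* (con 1ℤ :+ j) :+ con 1ℤ ⇒
            + 2 :* h :≤ con 1ℤ :+ s ⇒
            s :≤ + 2 :* (M :- r) :- con 1ℤ :+ k ⇒ con 0ℤ :≤ k ⇒ con 0ℤ :≤ j ⇒ v :+ (con 1ℤ :+ j) :≡ M ⇒
            con 0ℤ :≤ b ⇒ con 0ℤ :≤ c ⇒ v :- r :+ b :+ c :≤ S ⇒ a :≤ k :+ S)
          (above w P p) (ramp (h₁ - + 2 * p + 1ℤ)) h₁ (size w) M (+ r) k (remaining P p) (ramp (- p))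
          (ramp (- + r - p)) (+ j)
          (ramp (slack (+ r) P p))
          bound eq (proj₂ (proj₂ (half-up (0≤size w)))) small 0≤k (+≤+ z≤n) (crit p p≤M)
          (0≤ramp (- p)) (0≤ramp (- + r - p)) (a≤ramp (slack (+ r) P p))
        by-cases (inj₁ (eq , _)) (no p≰M) = linear 9
          (λ a R h s M r k j S → a :≤ R ⇒ R :≡ h :- + 2 :* (con 1ℤ :+ j) :+ con 1ℤ ⇒
            + 2 :* h :≤ con 1ℤ :+ s ⇒
            s :≤ + 2 :* (M :- r) :- con 1ℤ :+ k ⇒ con 0ℤ :≤ k ⇒ con 1ℤ :+ M :≤ con 1ℤ :+ j ⇒ con 1ℤ :≤ M ⇒ con 0ℤ :≤ r ⇒
            con 0ℤ :≤ S ⇒ a :≤ k :+ S)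
          (above w P p) (ramp (h₁ - + 2 * p + 1ℤ)) h₁ (size w) M (+ r) k (+ j)
          (ramp (slack (+ r) P p))
          bound eq (proj₂ (proj₂ (half-up (0≤size w)))) small 0≤k (i<j⇒suc[i]≤j (≰⇒> p≰M)) 1≤M (+≤+ z≤n)
          (0≤ramp (slack (+ r) P p))

      -- In the mirror image `spread` bounds the uncoloured chips left of - j. Since 2 (M - j - 1)
      -- chips stand there, enough of them are coloured to limit those at or right of - j.
      sifted-left : ∀ j → + suc j ≤ M → r ℕ.≤ j → above w P (- + j) ≤ k + (M - + 2 * + r + + j)
      sifted-left j j<M r≤j = by-cases (ramp-cases (h₂ - + 2 * p + 1ℤ))
        where
        p : ℤ
        p = +[1+ j ]
        mP : Positions n
        mP = mirror P
        crit′ : Critical mP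
        crit′ = Critical-mirror ρ crit
        bound : above nw mP p ≤ ramp (h₂ - + 2 * p + 1ℤ)
        bound = spread {nw} {mP} {h₂} {size nw} (Critical-crowd {mP} crit′) (Critical-empty {mP} crit′)
          (below-mirror ρ h₂ (proj₁ (proj₂ (half-up (0≤size nw))))) p (+≤+ (s≤s z≤n))
        total : above everyone mP p ≡ + 2 * (M - p)
        total = linear 5 (λ a v v′ M j → a :+ v :≡ + 2 :* (M :- (con 1ℤ :+ j)) :+ con 1ℤ :+ v′ ⇒
          v :+ j :≡ M ⇒
            v′ :+ (con 1ℤ :+ j) :≡ M ⇒ a :≡ + 2 :* (M :- (con 1ℤ :+ j)))
          (above everyone mP p) (remaining mP (+ j)) (remaining mP p) M (+ j)
          (above⁺ {mP} j j<M) (crit′ (+ j) (≤-trans (i≤suc[i] (+ j)) j<M)) (crit′ p j<M)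
        reflected : above w P (- + j) + above w mP p ≡ size w
        reflected = subst (λ q → above w P (- + j) + above w mP q ≡ size w) (flip-suc j) (above-mirror w P (- + j))
        by-cases : ramp (h₂ - + 2 * p + 1ℤ) ≡ h₂ - + 2 * p + 1ℤ × 0ℤ ≤ h₂ - + 2 * p + 1ℤ ⊎
                   ramp (h₂ - + 2 * p + 1ℤ) ≡ 0ℤ × h₂ - + 2 * p + 1ℤ ≤ -1ℤ →
                   above w P (- + j) ≤ k + (M - + 2 * + r + + j)
        by-cases (inj₂ (eq , _)) = linear 10
          (λ a b o t R s M r k j → a :+ b :≡ s ⇒ b :+ o :≡ t ⇒ t :≡ + 2 :* (M :- (con 1ℤ :+ j)) ⇒
            o :≤ R ⇒ R :≡ con 0ℤ ⇒
            s :≤ + 2 :* (M :- r) :- con 1ℤ :+ k ⇒ con 1ℤ :+ j :≤ M ⇒ a :≤ k :+ (M :- + 2 :* r :+ j))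
          (above w P (- + j)) (above w mP p) (above nw mP p) (above everyone mP p)
          (ramp (h₂ - + 2 * p + 1ℤ)) (size w) M (+ r) k (+ j)
          reflected (tally-not w mP (λ a → step (a - p))) total bound eq small j<M
        by-cases (inj₁ (eq , _)) = linear 12
          (λ a b o t R s s′ h M r k j → a :+ b :≡ s ⇒ b :+ o :≡ t ⇒ t :≡ + 2 :* (M :- (con 1ℤ :+ j)) ⇒
            o :≤ R ⇒
            R :≡ h :- + 2 :* (con 1ℤ :+ j) :+ con 1ℤ ⇒ + 2 :* h :≤ con 1ℤ :+ s′ ⇒ s :+ s′ :≡ + 4 :* M :- con 1ℤ ⇒
            s :≤ + 2 :* (M :- r) :- con 1ℤ :+ k ⇒ con 0ℤ :≤ k ⇒ r :≤ j ⇒ a :≤ k :+ (M :- + 2 :* r :+ j))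
          (above w P (- + j)) (above w mP p) (above nw mP p) (above everyone mP p)
          (ramp (h₂ - + 2 * p + 1ℤ))
          (size w) (size nw) h₂ M (+ r) k (+ j)
          reflected (tally-not w mP (λ a → step (a - p))) total bound eq (proj₂ (proj₂ (half-up (0≤size nw))))
          (complement w) small 0≤k (+≤+ r≤j)

      sifted⁻ : ∀ j → above w P (- + j) ≤ k + ramp (slack (+ r) P (- + j))
      sifted⁻ j = by-cases (+ suc j ≤? M) (r ℕₚ.≤? j)
        where
        b≥ : + j ≤ ramp (- - + j)
        b≥ = subst (_≤ ramp (- - + j)) (neg-involutive (+ j)) (a≤ramp (- - + j))
        c≥ : + j - + r ≤ ramp (- + r - - + j)
        c≥ = subst (_≤ ramp (- + r - - + j)) (swap (+ r) (+ j)) (a≤ramp (- + r - - + j))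
          where
          swap : ∀ r j → - r - - j ≡ j - r
          swap = solve-∀
        level : + suc j ≤ M → remaining P (- + j) + + j ≡ M
        level j<M = subst (λ a → remaining P (- + j) + + a ≡ M) (∣-i∣≡∣i∣ (+ j))
          (crit (- + j) (subst (λ a → + a ≤ M) (sym (∣-i∣≡∣i∣ (+ j))) (≤-trans (i≤suc[i] (+ j)) j<M)))
        by-cases : Dec (+ suc j ≤ M) → Dec (r ℕ.≤ j) → above w P (- + j) ≤ k + ramp (slack (+ r) P (- + j))
        by-cases (yes j<M) (yes r≤j) = linear 9
          (λ a M r k j v b c S → a :≤ k :+ (M :- + 2 :* r :+ j) ⇒ v :+ j :≡ M ⇒ j :≤ b ⇒ j :- r :≤ c ⇒
            v :- r :+ b :+ c :≤ S ⇒ a :≤ k :+ S)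
          (above w P (- + j)) M (+ r) k (+ j) (remaining P (- + j)) (ramp (- - + j))
          (ramp (- + r - - + j)) (ramp (slack (+ r) P (- + j)))
          (sifted-left j j<M r≤j) (level j<M) b≥ c≥ (a≤ramp (slack (+ r) P (- + j)))
        -- Between - r and 0 the slack is constantly M - r, so the bound at - r carries over.
        by-cases (yes j<M) (no r≰j) = linear 10
          (λ a a′ M r k j v b c S → a :≤ a′ ⇒ a′ :≤ k :+ (M :- + 2 :* r :+ r) ⇒ v :+ j :≡ M ⇒ j :≤ b ⇒
            con 0ℤ :≤ c ⇒
            v :- r :+ b :+ c :≤ S ⇒ a :≤ k :+ S)
          (above w P (- + j)) (above w P (- + r)) M (+ r) k (+ j) (remaining P (- + j))
          (ramp (- - + j)) (ramp (- + r - - + j)) (ramp (slack (+ r) P (- + j)))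
          (above-anti w P (neg-mono-≤ (+≤+ (ℕₚ.≰⇒≥ r≰j)))) (sifted-left r r<M ℕₚ.≤-refl) (level j<M) b≥
          (0≤ramp (- + r - - + j)) (a≤ramp (slack (+ r) P (- + j)))
        -- This far left the slack is at least 2 (M - r), so the size of the whole colour suffices.
        by-cases (no j≮M) _ = linear 10
          (λ a s M r k j v b c S → a :≤ s ⇒ s :≤ + 2 :* (M :- r) :- con 1ℤ :+ k ⇒
            con 1ℤ :+ M :≤ con 1ℤ :+ j ⇒ con 0ℤ :≤ v ⇒
            j :≤ b ⇒ j :- r :≤ c ⇒ v :- r :+ b :+ c :≤ S ⇒ a :≤ k :+ S)
          (above w P (- + j)) (size w) M (+ r) k (+ j) (remaining P (- + j)) (ramp (- - + j))
          (ramp (- + r - - + j)) (ramp (slack (+ r) P (- + j)))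
          (above≤size w P (- + j)) small (i<j⇒suc[i]≤j (≰⇒> j≮M)) (0≤remaining ρ (- + j)) b≥ c≥
          (a≤ramp (slack (+ r) P (- + j)))

    -- The constant 2 (M - r) - 1 in `small` counts the final places left of - r: one at - M and two
    -- at each of the M - r - 1 sites from there to - r.
    Sifted-critical : Sifted w (+ r) k P
    Sifted-critical (+ 0) = sifted⁻ 0
    Sifted-critical +[1+ j ] = sifted⁺ j
    Sifted-critical -[1+ j ] = sifted⁻ (suc j)

  -- Stable configurations have no firings left

  module _ (r : ℕ → ℤ) (m : ℕ) (0≤r : ∀ j → 0ℤ ≤ r j) (rm≤0 : r m ≤ 0ℤ)
           (convex : ∀ j → suc j ℕ.< m → + 2 * r (suc j) ≤ r j + r (suc (suc j))) where

    -- By convexity a function that once fails to descend never descends again, and its value at m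
    -- is at most 0.
    convex-grow : ∀ d j → j ℕ.+ suc d ≡ m → r j ≤ r (suc j) → r j ≤ 0ℤ
    convex-grow zero j refl h = ≤-trans h (subst (λ t → r t ≤ 0ℤ) (ℕₚ.+-comm j 1) rm≤0)
    convex-grow (suc d) j eq h = ≤-trans h (convex-grow d (suc j) (trans (sym (ℕₚ.+-suc j (suc d))) eq)
      (linear 3 (λ a b c → + 2 :* b :≤ a :+ c ⇒ a :≤ b ⇒ b :≤ c) (r j) (r (suc j)) (r (suc (suc j)))
        (convex j (subst (suc j ℕ.<_) eq (subst (suc j ℕ.<_) (sym (trans (ℕₚ.+-suc j (suc d)) (cong suc (ℕₚ.+-suc j d)))) (s≤s (s≤s (ℕₚ.m≤m+n j d)))))) h))

    convex-descent : ∀ j → j ℕ.< m → 1ℤ + r (suc j) ≤ r j ⊎ r j ≤ 0ℤ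
    convex-descent j j<m with r j ≤? r (suc j)
    ... | yes h = inj₂ (convex-grow (m ℕ.∸ suc j) j (trans (ℕₚ.+-suc j _) (ℕₚ.m+[n∸m]≡n j<m)) h)
    ... | no h = inj₁ (i<j⇒suc[i]≤j (≰⇒> h))

    convex-zero : r 0 ≤ 0ℤ → ∀ j → j ℕ.≤ m → r j ≤ 0ℤ
    convex-zero r0≤0 zero _ = r0≤0
    convex-zero r0≤0 (suc j) j<m with ℕₚ.m≤n⇒m<n∨m≡n j<m
    ... | inj₂ refl = rm≤0
    ... | inj₁ 1+j<m with convex-descent (suc j) 1+j<m
    ...   | inj₂ h = h
    ...   | inj₁ h = linear 3 (λ a b c → a :≤ con 0ℤ ⇒ con 1ℤ :+ c :≤ b ⇒ + 2 :* b :≤ a :+ c ⇒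
      b :≤ con 0ℤ)
      (r j) (r (suc j)) (r (suc (suc j))) (convex-zero r0≤0 j (ℕₚ.<⇒≤ j<m)) h (convex j 1+j<m)

  0≤M : 0ℤ ≤ M
  0≤M = ≤-trans (+≤+ z≤n) 1≤M

  m : ℕ
  m = ∣ M ∣

  +m≡M : + m ≡ M
  +m≡M = 0≤i⇒+∣i∣≡i 0≤M

  1≤m : 1 ℕ.≤ m
  1≤m = drop‿+≤+ (subst (1ℤ ≤_) (sym +m≡M) 1≤M)

  curvature-2 : ∀ j → suc j ℕ.< m → ramp (sucℤ (H - + 2 * + suc j)) - ramp (predℤ (H - + 2 * + suc j)) ≡ + 2
  curvature-2 j j<m = linear 4 (λ a b M j → a :≡ con 1ℤ :+ (+ 2 :* M :- + 2 :* (con 1ℤ :+ j)) ⇒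
      b :≡ con -1ℤ :+ (+ 2 :* M :- + 2 :* (con 1ℤ :+ j)) ⇒ a :- b :≡ con (+ 2))
    (ramp (sucℤ K)) (ramp (predℤ K)) M (+ j)
    (ramp-pos (linear 2 (λ M j → con (+ 2) :+ j :≤ M ⇒ con 0ℤ :≤ con 1ℤ :+ (+ 2 :* M :- + 2 :* (con 1ℤ :+ j))) M (+ j) lt))
    (ramp-pos (linear 2 (λ M j → con (+ 2) :+ j :≤ M ⇒ con 0ℤ :≤ con -1ℤ :+ (+ 2 :* M :- + 2 :* (con 1ℤ :+ j))) M (+ j) lt))
    where
    K : ℤ
    K = H - + 2 * + suc j
    lt : + suc (suc j) ≤ M
    lt = subst (+ suc (suc j) ≤_) +m≡M (+≤+ j<m)

  module _ {w P} (ρ : Reachable w P) (stable : ∀ p → here everyone P p ≤ + 2) where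

    private
      v : ℤ → ℤ
      v = remaining P

      edge : ∀ p → ∣ p ∣ ≡ m → v p ≤ 0ℤ
      edge p ∣p∣≡m = subst (v p ≤_) (cong quarter (trans (cong (λ a → H - + 2 * a) (trans (cong +_ ∣p∣≡m) +m≡M)) (+-inverseʳ H))) (remaining≤ ρ p)

      convexᵣ : ∀ j → suc j ℕ.< m → + 2 * v (+ suc j) ≤ v (+ j) + v (+ suc (suc j))
      convexᵣ j j<m = linear 5 (λ a b c h k → a :+ c :+ h :≡ + 2 :* b :+ k ⇒ k :≡ con (+ 2) ⇒
        h :≤ con (+ 2) ⇒ + 2 :* b :≤ a :+ c)
        (v (+ j)) (v (+ suc j)) (v (+ suc (suc j))) (here everyone P (+ suc j))
        (curvature H N (+ suc j))
        (remaining-Δ P (+ suc j)) (curvature-2 j j<m) (stable (+ suc j))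

      convexₗ : ∀ j → suc j ℕ.< m → + 2 * v (- + suc j) ≤ v (- + j) + v (- + suc (suc j))
      convexₗ j j<m = linear 5 (λ a b c h k → c :+ a :+ h :≡ + 2 :* b :+ k ⇒ k :≡ con (+ 2) ⇒
        h :≤ con (+ 2) ⇒ + 2 :* b :≤ a :+ c)
        (v (- + j)) (v (- + suc j)) (v (- + suc (suc j))) (here everyone P (- + suc j))
        (curvature H N (- + suc j))
        (subst (λ q → v (- + suc (suc j)) + v q + here everyone P (- + suc j) ≡ + 2 * v (- + suc j) + curvature H N (- + suc j))
          (sucℤ-neg j) (remaining-Δ P (- + suc j)))
        (curvature-2 j j<m) (stable (- + suc j))

      -- A fall on both sides of 0 would make the second difference there at most - 2; curvature 1
      -- and at most two chips make it at least - 1.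
      centre : v 0ℤ ≤ 0ℤ
      centre = by-cases (convex-descent (λ j → v (+ j)) m (λ j → 0≤remaining ρ (+ j)) (edge (+ m) refl) convexᵣ 0 1≤m)
                        (convex-descent (λ j → v (- + j)) m (λ j → 0≤remaining ρ (- + j)) (edge (- + m) (∣-i∣≡∣i∣ (+ m))) convexₗ 0 1≤m)
        where
        by-cases : 1ℤ + v 1ℤ ≤ v 0ℤ ⊎ v 0ℤ ≤ 0ℤ → 1ℤ + v -1ℤ ≤ v 0ℤ ⊎ v 0ℤ ≤ 0ℤ → v 0ℤ ≤ 0ℤ
        by-cases (inj₂ h) _ = h
        by-cases (inj₁ _) (inj₂ h) = h
        by-cases (inj₁ h) (inj₁ h′) = linear 5 (λ a b c h k → b :+ c :+ h :≡ + 2 :* a :+ k ⇒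
          k :≡ con 1ℤ ⇒ h :≤ con (+ 2) ⇒
            con 1ℤ :+ c :≤ a ⇒ con 1ℤ :+ b :≤ a ⇒ a :≤ con 0ℤ)
          (v 0ℤ) (v -1ℤ) (v 1ℤ) (here everyone P 0ℤ) (curvature H N 0ℤ) (remaining-Δ P 0ℤ) curvature-0
          (stable 0ℤ) h h′

    stable-remaining : ∀ p → + ∣ p ∣ ≤ M → remaining P p ≡ 0ℤ
    stable-remaining p p≤M = ≤-antisym (by-sign p (drop‿+≤+ (subst (+ ∣ p ∣ ≤_) (sym +m≡M) p≤M))) (0≤remaining ρ p)
      where
      by-sign : ∀ p → ∣ p ∣ ℕ.≤ m → v p ≤ 0ℤ
      by-sign (+ j) j≤m = convex-zero (λ j → v (+ j)) m (λ j → 0≤remaining ρ (+ j)) (edge (+ m) refl) convexᵣ centre j j≤m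
      by-sign -[1+ j ] j≤m = convex-zero (λ j → v (- + j)) m (λ j → 0≤remaining ρ (- + j)) (edge (- + m) (∣-i∣≡∣i∣ (+ m))) convexₗ centre (suc j) j≤m

  late-at-end : ∀ {w P} → Reachable w P → (∀ p → here everyone P p ≤ + 2) → ∀ p → + ∣ p ∣ ≤ M → Late P p
  late-at-end ρ stable p p≤M =
    subst (_≤ M) (sym (trans (cong (_+ + ∣ p ∣) (stable-remaining ρ stable p p≤M)) (+-identityˡ (+ ∣ p ∣)))) p≤M

  -- The line is reached at Q from both sides: early firings never take a count below it, and the
  -- vanishing final counts show that every site within M was late before the late firings began.
  critical-state : ∀ {w O P} → (∀ c → O c ≡ 0ℤ) → Star (AnyMove w) O P → (∀ p → here everyone P p ≤ + 2) →
                   ∃ λ Q → Reachable w Q × Critical Q × Star (LateStep w) Q P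
  critical-state {w} {O} {P} O≡0 run stable = finish (reorder w (regular start) run)
    where
    start : Reachable w O
    start = Reachable-origin O≡0
    finish : (∃ λ Q → Star (EarlyStep w) O Q × Star (LateStep w) Q P) →
             ∃ λ Q → Reachable w Q × Critical Q × Star (LateStep w) Q P
    finish (Q , es , ls) = Q , Reachable-early es start ,
      (λ p p≤M → ≤-antisym (late-before ls p (late-at-end (Reachable-run run start) stable p p≤M))
        (early-keeps es p (subst (λ v → M ≤ v + + ∣ p ∣) (sym (remaining-origin O≡0 p)) (parabola p)))) ,
      ls

  -- With `P b` at - r - 1, let A be the number of coloured chips at or right of - r and k = A - 1.
  -- The uncoloured b occupies one of the places left of - r, so the size hypothesis holds for this
  -- smaller k, and sifting yields A ≤ A - 1.
  no-inversion : ∀ {w O P} → (∀ c → O c ≡ 0ℤ) → Star (AnyMove w) O P → (∀ p → here everyone P p ≤ + 2) →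
                 ∀ {a b} → T (w a) → T (not (w b)) → P b < P a → P b < 0ℤ → ⊥
  no-inversion {w} {O} {P} O≡0 run stable {a} {b} wa wb Pb<Pa Pb<0 = go (P b) refl Pb<0
    where
    ρ : Reachable w P
    ρ = Reachable-run run (Reachable-origin O≡0)
    nw : Colouring n
    nw = not ∘ w
    mP : Positions n
    mP = mirror P
    go : ∀ q → P b ≡ q → q < 0ℤ → ⊥
    go (+ _) _ (+<+ ())
    go -[1+ r ] Pb _ = finish (critical-state O≡0 run stable)
      where
      one : 1ℤ ≤ above nw mP (+ suc r)
      one = above-∋ nw mP wb (≤-reflexive (cong -_ (sym Pb)))
      one′ : 1ℤ ≤ above everyone mP (+ suc r)
      one′ = above-∋ everyone mP {b} tt (≤-reflexive (cong -_ (sym Pb)))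
      0≤v′ : ∀ p → 0ℤ ≤ remaining mP p
      0≤v′ p = subst (0ℤ ≤_) (sym (symmetric ρ p)) (0≤remaining ρ (- p))
      v′≡0 : ∀ p → + ∣ p ∣ ≤ M → remaining mP p ≡ 0ℤ
      v′≡0 p p≤M = trans (symmetric ρ p)
        (stable-remaining ρ stable (- p) (subst (λ a → + a ≤ M) (sym (∣-i∣≡∣i∣ p)) p≤M))
      -- A chip left of - M would give the mirrored configuration a positive excess at r, where the
      -- barrier is zero.
      r<M : + suc r ≤ M
      r<M = ≮⇒≥ λ M<1+r → 1≰0 (linear 5 (λ e e′ a q v → e :≡ e′ :+ a ⇒ e :≡ q :- v ⇒ con 1ℤ :≤ a ⇒ con 0ℤ :≤ e′ ⇒
          con 0ℤ :≤ v ⇒ q :≤ con 0ℤ ⇒ con 1ℤ :≤ con 0ℤ)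
        (excess everyone mP (+ r)) (excess everyone mP (+ suc r)) (above everyone mP (+ suc r))
        (quarter (H - + 2 * + r)) (remaining mP (+ r))
        (excess-pred everyone mP (+ suc r)) (excess⁺ {mP} r) one′ (0≤excess everyone mP (+ suc r))
        (0≤v′ (+ r))
        (quarter-mono (linear 2 (λ M r → con 1ℤ :+ M :≤ con 1ℤ :+ r ⇒ + 2 :* M :- + 2 :* r :≤ con 0ℤ) M (+ r) (i<j⇒suc[i]≤j M<1+r))))
      A : ℤ
      A = above w P (- + r)
      1≤A : 1ℤ ≤ A
      1≤A = above-∋ w P wa (subst (_≤ P a) (trans (cong sucℤ Pb) (sucℤ-neg r)) (i<j⇒suc[i]≤j Pb<Pa))
      small : size w ≤ + 2 * (M - + r) - 1ℤ + (A - 1ℤ)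
      small = linear 9 (λ s A x y t M r v v′ → A :+ x :≡ s ⇒ x :+ y :≡ t ⇒ con 1ℤ :≤ y ⇒
          t :+ v :≡ + 2 :* (M :- (con 1ℤ :+ r)) :+ con 1ℤ :+ v′ ⇒ v :≡ con 0ℤ ⇒ v′ :≡ con 0ℤ ⇒
          s :≤ + 2 :* (M :- r) :- con 1ℤ :+ (A :- con 1ℤ))
        (size w) A (above w mP (+ suc r)) (above nw mP (+ suc r)) (above everyone mP (+ suc r)) M (+ r)
        (remaining mP (+ r)) (remaining mP (+ suc r))
        (subst (λ q → A + above w mP q ≡ size w) (flip-suc r) (above-mirror w P (- + r)))
        (tally-not w mP (λ c → step (c - + suc r))) one (above⁺ {mP} r r<M)
        (v′≡0 (+ r) (≤-trans (i≤suc[i] (+ r)) r<M)) (v′≡0 (+ suc r) r<M)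
      level : slack (+ r) P (- + r) ≡ 0ℤ
      level = linear 4 (λ v b c r → v :≡ con 0ℤ ⇒ b :≡ r ⇒ c :≡ con 0ℤ ⇒ v :- r :+ b :+ c :≡ con 0ℤ)
        (remaining P (- + r)) (ramp (- - + r)) (ramp (- + r - - + r)) (+ r)
        (stable-remaining ρ stable (- + r) (subst (λ a → + a ≤ M) (sym (∣-i∣≡∣i∣ (+ r))) (≤-trans (i≤suc[i] (+ r)) r<M)))
        (cong ramp (neg-involutive (+ r))) (cong ramp (+-inverseʳ (- + r)))
      finish : (∃ λ Q → Reachable w Q × Critical Q × Star (LateStep w) Q P) → ⊥
      finish (Q , ρ′ , crit , ls) = 1≰0 (linear 2 (λ A S → A :≤ (A :- con 1ℤ) :+ S ⇒ S :≡ con 0ℤ ⇒ con 1ℤ :≤ con 0ℤ)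
        A (ramp (slack (+ r) P (- + r)))
        (Sifted-late (+ r) (A - 1ℤ) (regular ρ′) ls
          (Sifted-critical ρ′ crit r (A - 1ℤ) r<M (i≤j⇒0≤j-i 1≤A) small) (- + r))
        (cong ramp level))

-- Labelled chips

size-everyone : ∀ n → size {n} everyone ≡ + n
size-everyone zero = refl
size-everyone (suc n) = cong sucℤ (size-everyone n)

count≡here : ∀ {n} (p : Vec ℤ n) i → + count (_≟ i) p ≡ here everyone (lookup p) i
count≡here [] i = refl
count≡here (a ∷ p) i with a ≟ i
... | yes refl = cong₂ _+_ (sym (cong spike (+-inverseʳ a))) (count≡here p i)
... | no a≢i = trans (sym (+-identityˡ (+ count (_≟ i) p)))
                     (cong₂ _+_ (sym (spike-≢ (a≢i ∘ i-j≡0⇒i≡j a i))) (count≡here p i))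

here-mirror : ∀ {n} (P : Positions n) p → here everyone (mirror P) p ≡ here everyone P (- p)
here-mirror P p = sum-cong-≗ (λ c → trans (cong spike (flip (P c) p)) (spike-neg (P c - - p)))
  where
  flip : ∀ a p → - a - p ≡ - (a - - p)
  flip = solve-∀

run-mirror : ∀ {n} {w : Colouring n} {P P′} → Star (AnyMove w) P P′ → Star (AnyMove (not ∘ w)) (mirror P) (mirror P′)
run-mirror ε = ε
run-mirror ((i , mv) ◅ run) = (- i , Move-mirror mv) ◅ run-mirror run

-- Colouring by label

module LowerSets {c ℓ₁ ℓ₂} (O : TotalOrder c ℓ₁ ℓ₂) {n} (label : Fin n → TotalOrder.Carrier O)
                 (injective : Injective _≡_ (TotalOrder._≈_ O) label) where

  open TotalOrder O using (module Eq) renaming (_≤_ to _⊑_; total to ⊑-total; antisym to ⊑-antisym; trans to ⊑-trans; refl to ⊑-refl)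
  open LabeledFiring O label

  -- The order itself need not be decidable. Totality gives one comparison, and for distinct chips
  -- injectivity refutes the opposite one.
  ⊑-dec : ∀ x y → Dec (label x ⊑ label y)
  ⊑-dec x y with ⊑-total (label x) (label y) | x ≟ᶠ y
  ... | inj₁ x⊑y | _ = yes x⊑y
  ... | inj₂ _ | yes refl = yes ⊑-refl
  ... | inj₂ y⊑x | no x≢y = no λ x⊑y → x≢y (injective (⊑-antisym x⊑y y⊑x))

  lower : Fin n → Colouring n
  lower a x = ⌊ ⊑-dec x a ⌋

  ≺⇒≢ : ∀ {x y} → x ≺ y → x ≢ y
  ≺⇒≢ (_ , x≉y) refl = x≉y Eq.refl

  lower-closed : ∀ {a x y} → x ≺ y → T (lower a y) → T (lower a x)
  lower-closed {a} {x} {y} (x⊑y , _) y∈ = fromWitness (⊑-trans x⊑y (toWitness {a? = ⊑-dec y a} y∈))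

  lower-move : ∀ a {p q} → p ⟶ q → AnyMove (lower a) (lookup p) (lookup q)
  lower-move a {p} (fire i {x} {y} {z} px py pz x≺y y≺z) = i , record
    { x = x ; y = y ; z = z ; Px = px ; Py = py ; Pz = pz
    ; x≢y = ≺⇒≢ x≺y ; y≢z = ≺⇒≢ y≺z ; x≢z = x≢z
    ; P′x = trans (lookup∘updateAt′ x z x≢z (p Vec.[ x ]%= predℤ)) (trans (lookup∘updateAt x p) (cong predℤ px))
    ; P′z = trans (lookup∘updateAt z (p Vec.[ x ]%= predℤ))
              (cong sucℤ (trans (lookup∘updateAt′ z x (x≢z ∘ sym) p) pz))
    ; fixed = λ c c≢x c≢z → trans (lookup∘updateAt′ c z c≢z (p Vec.[ x ]%= predℤ)) (lookup∘updateAt′ c x c≢x p)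
    ; z⇒y = lower-closed {a} y≺z ; y⇒x = lower-closed {a} x≺y }
    where
    x≢z : x ≢ z
    x≢z refl = proj₂ x≺y (⊑-antisym (proj₁ x≺y) (proj₁ y≺z))

  lower-run : ∀ a {p q} → p ⟶* q → Star (AnyMove (lower a)) (lookup p) (lookup q)
  lower-run a ε = ε
  lower-run a (s ◅ run) = lower-move a s ◅ lower-run a run

  a∈lower : ∀ a → T (lower a a)
  a∈lower a = fromWitness ⊑-refl

  b∉lower : ∀ {a b} → a ≺ b → T (not (lower a b))
  b∉lower {a} {b} (a⊑b , a≉b) = fromWitnessFalse {a? = ⊑-dec b a} λ b⊑a → a≉b (⊑-antisym a⊑b b⊑a)

theorem3p13 : ∀ {c ℓ₁ ℓ₂} (O : TotalOrder c ℓ₁ ℓ₂) (n : ℕ) → n % 4 ≡ 3 →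
    (label : Fin n → TotalOrder.Carrier O) →
    Injective _≡_ (TotalOrder._≈_ O) label →
    let open LabeledFiring O label in
    ∀ (p : Config n) → initial n ⟶* p → Stable p →
    ∀ (a b : Fin n) → a ≺ b → lookup p a ≤ lookup p b
theorem3p13 O n n%4≡3 label injective p run stable a b a≺b = by-cases (lookup p a ≤? lookup p b) (lookup p b <? 0ℤ)
  where
  open LowerSets O label injective
  M : ℤ
  M = + suc (n ℕ./ 4)
  chips : size {n} everyone ≡ + 4 * M - 1ℤ
  chips = trans (size-everyone n) (trans (cong +_ (trans (m≡m%n+[m/n]*n n 4) (cong (ℕ._+ n ℕ./ 4 ℕ.* 4) n%4≡3)))
    (trans (cong (λ t → + 3 + t) (pos-* (n ℕ./ 4) 4)) (linear-form (+ (n ℕ./ 4)))))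
    where
    linear-form : ∀ q → + 3 + q * + 4 ≡ + 4 * (1ℤ + q) - 1ℤ
    linear-form = solve-∀
  open Firing {n} M (+≤+ (s≤s z≤n)) chips
  P : Positions n
  P = lookup p
  few : ∀ i → here everyone P i ≤ + 2
  few i = subst (_≤ + 2) (count≡here p i) (+≤+ (stable i))
  origin : ∀ c → lookup (initial n) c ≡ 0ℤ
  origin c = lookup-replicate c 0ℤ
  by-cases : Dec (P a ≤ P b) → Dec (P b < 0ℤ) → P a ≤ P b
  by-cases (yes h) _ = h
  by-cases (no h) (yes Pb<0) = ⊥-elim (no-inversion origin (lower-run a run) few
    {a} {b} (a∈lower a) (b∉lower a≺b) (≰⇒> h) Pb<0)
  -- Here 0 ≤ P b < P a. In the mirror image a lies left of b and of 0, and it is the chip outside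
  -- the complementary colour.
  by-cases (no h) (no Pb≮0) = ⊥-elim (no-inversion (λ c → cong -_ (origin c)) (run-mirror (lower-run a run))
    (λ i → subst (_≤ + 2) (sym (here-mirror P i)) (few (- i)))
    {b} {a} (b∉lower a≺b) (fromWitnessFalse′ (a∈lower a)) (neg-mono-< (≰⇒> h))
    (neg-mono-< (≤-<-trans (≮⇒≥ Pb≮0) (≰⇒> h))))
    where
    fromWitnessFalse′ : ∀ {b} → T b → T (not (not b))
    fromWitnessFalse′ {true} _ = tt
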